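{- Let $m$ be a positive integer, $F=\mathbb{F}_{2^m}$, and let $a\in F\setminus\{0,1\}$ be a third root of unity (i.e. $a^3=1$, equivalently $a^2+a+1=0$). Then \[ K(a)\equiv\begin{cases}7\pmod{12}, & \text{if } \mathrm{Tr}(a)=0,\\ 11\pmod{12}, & \text{if } \mathrm{Tr}(a)=1.\end{cases} \]
   Context: $\mathrm{Tr}$ denotes the absolute trace from $F=\mathbb{F}_{2^m}$ to $\mathbb{F}_2$, $\mathrm{Tr}(x)=\sum_{i=0}^{m-1}x^{2^i}$. For $a\in F\setminus\{0\}$, the Kloosterman sum is $K(a)=\sum_{x\in F\setminus\{0\}}(-1)^{\mathrm{Tr}(ax+1/x)}$. -}

module Defs where

open import Relation.Binary.PropositionalEquality using (_≡_)
open import Level using (Level; _⊔_; suc)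
open import Data.Nat as ℕ using (ℕ; zero)
open import Data.Integer as ℤ using (ℤ; +_; -[1+_])
open import Data.List using (List; length; filter; map; foldr)
open import Data.List.Relation.Unary.Any using (Any)
open import Relation.Nullary using (¬_; Dec; yes; no)
open import Relation.Nullary.Decidable using (¬?)
open import Algebra.Bundles using (CommutativeRing)
import Data.List.Relation.Unary.Unique.Setoid as UniqueS

-- A finite field with exactly 2^m elements (hence characteristic 2),
-- i.e. a model of F_{2^m} (unique up to isomorphism).
record FiniteField2^ (m : ℕ) (c ℓ : Level) : Set (suc (c ⊔ ℓ)) where
  field
    commRing : CommutativeRing c ℓ
  open CommutativeRing commRing public
  field
    _≟_      : (x y : Carrier) → Dec (x ≈ y)
    0≉1      : ¬ (0# ≈ 1#)
    _⁻¹      : Carrier → Carrier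
    inverseʳ : ∀ x → ¬ (x ≈ 0#) → x * (x ⁻¹) ≈ 1#
    elements : List Carrier
    complete : ∀ x → Any (x ≈_) elements
    unique   : UniqueS.Unique setoid elements
    card     : length elements ≡ 2 ℕ.^ m

  pow : Carrier → ℕ → Carrier
  pow x zero        = 1#
  pow x (ℕ.suc n)   = x * pow x n

  Tr : Carrier → Carrier
  Tr x = go m
    where
    go : ℕ → Carrier
    go zero      = 0#
    go (ℕ.suc i) = pow x (2 ℕ.^ i) + go i

  -- (-1)^{Tr y} as an integer (Tr y ∈ {0,1})
  sign : Carrier → ℤ
  sign y with Tr y ≟ 0#
  ... | yes _ = + 1
  ... | no  _ = -[1+ 0 ]

  nonzero : List Carrier
  nonzero = filter (λ x → ¬? (x ≟ 0#)) elements

  K : Carrier → ℤ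
  K a = foldr ℤ._+_ (+ 0) (map (λ x → sign (a * x + x ⁻¹)) nonzero)

{-# OPTIONS --safe #-}

-- Write f x = a x + 1/x, q = 2^m and N for the number of x ≠ 0 with Tr (f x) = 1, so that
-- K a = q − 1 − 2N.
--
-- Modulo 4: x ↦ 1/(a x) preserves f and its fixed points satisfy f x = 0, so it acts without
-- fixed points on {Tr (f x) = 1}; hence N is even, and K a ≡ −1.
--
-- Modulo 3: multiplication by a acts freely on the nonzero elements, so q ≡ 1.
-- The cubic A B (A + B + 1) = a has the symmetry (A , B) ↦ (B , A + B + 1) of order 3, which
-- permutes the factors; it has no fixed point on the curve since a ≠ 1, so 3 divides the number
-- of points.  Projecting to v = 1 + 1/A turns the curve into y² + y = f v + a², together with
-- the point (1 , a²), where v = 0, and without the two points over v = 1.  By additive Hilbert 90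
-- the number of points is thus 2W − 1, where W counts the v ≠ 0 with Tr (f v) = Tr (a²) = Tr a;
-- and W is q − 1 − N or N according to the value of Tr a.
module Submission where

open import Defs
open import Level using (Level; _⊔_)
open import Algebra.Bundles using (RawRing)
import Algebra.Properties.Ring
import Algebra.Properties.Semiring.Mult
import Algebra.Solver.Ring
open import Algebra.Solver.Ring.AlmostCommutativeRing using (fromCommutativeRing; _-Raw-AlmostCommutative⟶_)
open import Data.Bool as Bool using (Bool; true; false; _xor_; _∧_)
open import Data.Integer as ℤ using (ℤ; +_)
open import Data.Integer.Divisibility using (_∣_)
open import Data.Integer.Divisibility.Signed using (∣ᵤ⇒∣; ∣⇒∣ᵤ; ∣m∣n⇒∣m-n) renaming (_∣_ to _∣ₛ_; divides to dividesₛ)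
import Data.Integer.Properties as ℤ
import Data.Integer.Solver as ℤ
open import Data.List using (List; []; _∷_; length; filter; map; foldr)
import Data.List.Membership.Setoid
import Data.List.Membership.Setoid.Properties as Membership
import Data.List.Properties as List
import Data.List.Relation.Binary.Permutation.Setoid
import Data.List.Relation.Binary.Permutation.Setoid.Properties
open import Data.List.Relation.Unary.All as All using (All; []; _∷_)
open import Data.List.Relation.Unary.All.Properties using (¬Any⇒All¬)
open import Data.List.Relation.Unary.AllPairs using ([]; _∷_)
open import Data.List.Relation.Unary.Any as Any using (Any; here; there)
import Data.List.Relation.Unary.Unique.Setoid
import Data.List.Relation.Unary.Unique.Setoid.Properties as Unique
open import Data.Maybe using (just; nothing)
open import Data.Nat as ℕ using (ℕ; zero; suc; _≤_; _≥_; z≤n; s≤s)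
open import Data.Nat.Divisibility as ℕ using (divides)
open import Data.Nat.LCM using (lcm-least)
import Data.Nat.Properties as ℕ
open import Data.Product using (_×_; _,_; proj₁; proj₂; ∃)
import Data.Product.Properties as Product
open import Data.Product.Relation.Binary.Pointwise.NonDependent using (×-setoid)
open import Data.Sum as Sum using (_⊎_; inj₁; inj₂)
open import Data.Vec using (Vec; []; _∷_; replicate; zipWith)
open import Function using (_∘_)
open import Relation.Binary.Bundles using (Setoid)
open import Relation.Binary.Definitions using (WeaklyDecidable)
open import Relation.Binary.PropositionalEquality as ≡ using (_≡_)
import Relation.Binary.Reasoning.Setoid
open import Relation.Nullary using (¬_; Dec; yes; no; contradiction)
open import Relation.Nullary.Decidable using (¬?)
open import Relation.Unary using (Pred; Decidable)
open import Tactic.Cong using (cong!)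

-- Lengths of filtered lists.

module _ {a p} {A : Set a} {P : Pred A p} (P? : Decidable P) where

  length-filter-¬? : ∀ xs → length (filter P? xs) ℕ.+ length (filter (¬? ∘ P?) xs) ≡ length xs
  length-filter-¬? []       = ≡.refl
  length-filter-¬? (x ∷ xs) with P? x
  ... | yes _ = ≡.cong suc (length-filter-¬? xs)
  ... | no  _ = ≡.trans (ℕ.+-suc _ _) (≡.cong suc (length-filter-¬? xs))

-- Duplicate-free lists over a setoid, and free cyclic actions on them.

module UniqueLists {c ℓ} (S : Setoid c ℓ) where
  open Setoid S renaming (Carrier to A)
  open Data.List.Membership.Setoid S using (_∈_)
  open Data.List.Relation.Unary.Unique.Setoid S using (Unique)
  open Data.List.Relation.Binary.Permutation.Setoid S using (_↭_; prep; ↭-refl; ↭-sym; ↭-trans; ↭-prep; ↭-swap)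
  open Data.List.Relation.Binary.Permutation.Setoid.Properties S using (∈-resp-↭; Unique-resp-↭; xs↭ys⇒|xs|≡|ys|)

  module _ {p} {P : Pred A p} (P? : Decidable P) where

    -- `P` need not respect `≈`, so `P` is asked of every element equal to `v`; conversely
    -- `∈-filter⁻` returns `P` only for some representative.
    ∈-filter⁺ : ∀ {v xs} → v ∈ xs → (∀ {x} → v ≈ x → P x) → v ∈ filter P? xs
    ∈-filter⁺ {xs = x ∷ _} (here v≈x) Pv with P? x
    ... | yes _  = here v≈x
    ... | no ¬Px = contradiction (Pv v≈x) ¬Px
    ∈-filter⁺ {xs = x ∷ _} (there v∈xs) Pv with P? x
    ... | yes _ = there (∈-filter⁺ v∈xs Pv)
    ... | no  _ = ∈-filter⁺ v∈xs Pv

    ∈-filter⁻ : ∀ {v} xs → v ∈ filter P? xs → v ∈ xs × ∃ λ x → v ≈ x × P x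
    ∈-filter⁻ (x ∷ xs) v∈ with P? x
    ... | no  _ = let v∈xs , Pv = ∈-filter⁻ xs v∈ in there v∈xs , Pv
    ∈-filter⁻ (x ∷ xs) (here v≈x)  | yes Px = here v≈x , x , v≈x , Px
    ∈-filter⁻ (x ∷ xs) (there v∈) | yes Px = let v∈xs , Pv = ∈-filter⁻ xs v∈ in there v∈xs , Pv

  All≉⇒∉ : ∀ {x xs} → All (λ y → ¬ (x ≈ y)) xs → ¬ (x ∈ xs)
  All≉⇒∉ (x≉y ∷ _)  (here x≈y)   = x≉y x≈y
  All≉⇒∉ (_ ∷ x≉xs) (there x∈xs) = All≉⇒∉ x≉xs x∈xs

  ∉-tail : ∀ {x y xs} → Unique (x ∷ xs) → y ∈ xs → ¬ (y ≈ x)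
  ∉-tail (x≉xs ∷ _) y∈xs y≈x = All≉⇒∉ (All.map (λ x≉z y≈z → x≉z (trans (sym y≈x) y≈z)) x≉xs) y∈xs

  unique-tail : ∀ {x xs} → Unique (x ∷ xs) → Unique xs
  unique-tail (_ ∷ xs!) = xs!

  ∈-tail : ∀ {x y xs} → y ∈ x ∷ xs → ¬ (y ≈ x) → y ∈ xs
  ∈-tail (here y≈x)   y≉x = contradiction y≈x y≉x
  ∈-tail (there y∈xs) _   = y∈xs

  pull : ∀ {x xs} → x ∈ xs → ∃ λ ys → xs ↭ x ∷ ys
  pull {xs = _ ∷ xs} (here x≈y)   = xs , prep (sym x≈y) ↭-refl
  pull {xs = y ∷ _}  (there x∈xs) =
    let ys , xs↭ = pull x∈xs in y ∷ ys , ↭-trans (↭-prep y xs↭) (↭-swap y _ ↭-refl)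

  -- Induction on `xs`: `pull` moves its head to the front of `ys`, and uniqueness on both sides
  -- ensures that the two tails again have the same elements.
  same-elements⇒↭ : ∀ {xs ys} → Unique xs → Unique ys →
                    (∀ {z} → z ∈ xs → z ∈ ys) → (∀ {z} → z ∈ ys → z ∈ xs) → xs ↭ ys
  same-elements⇒↭ {[]}     {[]}    _ _ _ _ = ↭-refl
  same-elements⇒↭ {[]}     {_ ∷ _} _ _ _ ys⊆ with () ← ys⊆ (here refl)
  same-elements⇒↭ {x ∷ xs} xs! ys! xs⊆ ys⊆ =
    let zs , ys↭ = pull (xs⊆ (here refl))
        zs!      = Unique-resp-↭ ys↭ ys!
    in ↭-trans
         (↭-prep x (same-elements⇒↭ (unique-tail xs!) (unique-tail zs!)
           (λ z∈ → ∈-tail (∈-resp-↭ ys↭ (xs⊆ (there z∈))) (∉-tail xs! z∈))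
           (λ z∈ → ∈-tail (ys⊆ (∈-resp-↭ (↭-sym ys↭) (there z∈))) (∉-tail zs! z∈))))
         (↭-sym ys↭)

  -- The predicate `D` marks the region where `σ` is well behaved: an inverse, for instance, is not
  -- known to respect `≈` at zero, and freeness may fail elsewhere.
  module FreeAction {d} (D : A → Set d) (σ : A → A)
    (σ-cong : ∀ {x y} → D x → D y → x ≈ y → σ x ≈ σ y)
    (σ-free : ∀ {x} → D x → ¬ (σ x ≈ x)) where

    Closed : List A → Set (c ⊔ ℓ ⊔ d)
    Closed xs = (∀ {x} → x ∈ xs → D x) × (∀ {x} → x ∈ xs → σ x ∈ xs)

    -- Removes the orbit of the head, `x` and `σ x`, and recurses on the rest, which is still
    -- closed. The recursion runs on a bound for the length because the rest is only a permuted
    -- sublist.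
    2∣length : (∀ {x} → D x → σ (σ x) ≈ x) → ∀ xs → Unique xs → Closed xs → 2 ℕ.∣ length xs
    2∣length σ²≈id xs = go (length xs) xs ℕ.≤-refl
      where
      go : ∀ n xs → length xs ≤ n → Unique xs → Closed xs → 2 ℕ.∣ length xs
      go _ [] _ _ _ = divides 0 ≡.refl
      go (suc n) (x ∷ xs) (s≤s |xs|≤n) xs! (D∈ , σ∈) with pull (∈-tail (σ∈ (here refl)) (σ-free (D∈ (here refl))))
      ... | ys , xs↭ with go n ys |ys|≤n (unique-tail (unique-tail all!)) (D∈′ , σ∈′)
        where
        ↭₁ : x ∷ xs ↭ x ∷ σ x ∷ ys
        ↭₁ = ↭-prep x xs↭
        |ys|≤n = ℕ.≤-trans (ℕ.n≤1+n _) (≡.subst (_≤ n) (xs↭ys⇒|xs|≡|ys| xs↭) |xs|≤n)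
        all! = Unique-resp-↭ ↭₁ xs!
        Dx = D∈ (here refl)
        Dσx = D∈ (σ∈ (here refl))
        up : ∀ {z} → z ∈ ys → z ∈ x ∷ xs
        up z∈ = ∈-resp-↭ (↭-sym ↭₁) (there (there z∈))
        D∈′ : ∀ {z} → z ∈ ys → D z
        D∈′ = D∈ ∘ up
        σ∈′ : ∀ {z} → z ∈ ys → σ z ∈ ys
        σ∈′ z∈ = ∈-tail (∈-tail (∈-resp-↭ ↭₁ (σ∈ (up z∈)))
          (λ σz≈x → ∉-tail (unique-tail all!) z∈
             (trans (sym (σ²≈id (D∈′ z∈))) (σ-cong (D∈ (σ∈ (up z∈))) Dx σz≈x))))
          (λ σz≈σx → ∉-tail all! (there z∈)
             (trans (sym (σ²≈id (D∈′ z∈))) (trans (σ-cong (D∈ (σ∈ (up z∈))) Dσx σz≈σx) (σ²≈id Dx))))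
      ... | divides q |ys|≡ = divides (suc q) (≡.cong suc (≡.trans (xs↭ys⇒|xs|≡|ys| xs↭) (≡.cong suc |ys|≡)))

    -- As for involutions, but with orbits of three elements. They are distinct: σ² x = x would give
    -- σ x = σ³ x = x. The rest stays closed because `σ` is injective on the list.
    3∣length : (∀ {x} → D x → σ (σ (σ x)) ≈ x) → ∀ xs → Unique xs → Closed xs → 3 ℕ.∣ length xs
    3∣length σ³≈id xs = go (length xs) xs ℕ.≤-refl
      where
      go : ∀ n xs → length xs ≤ n → Unique xs → Closed xs → 3 ℕ.∣ length xs
      go _ [] _ _ _ = divides 0 ≡.refl
      go (suc n) (x ∷ xs) (s≤s |xs|≤n) xs! (D∈ , σ∈) with pull (∈-tail (σ∈ (here refl)) (σ-free (D∈ (here refl))))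
      ... | ys , xs↭ with pull (∈-tail (∈-tail (∈-resp-↭ (↭-prep x xs↭) σ²x∈) σ²x≉x) (σ-free Dσx))
        where
        Dσx = D∈ (σ∈ (here refl))
        σ²x∈ : σ (σ x) ∈ x ∷ xs
        σ²x∈ = σ∈ (σ∈ (here refl))
        σ²x≉x : ¬ (σ (σ x) ≈ x)
        σ²x≉x σ²x≈x = σ-free (D∈ (here refl))
          (trans (sym (σ-cong (D∈ σ²x∈) (D∈ (here refl)) σ²x≈x)) (σ³≈id (D∈ (here refl))))
      ... | zs , ys↭ with go n zs |zs|≤n (unique-tail (unique-tail (unique-tail all!))) (D∈′ , σ∈′)
        where
        ↭₁ : x ∷ xs ↭ x ∷ σ x ∷ σ (σ x) ∷ zs
        ↭₁ = ↭-prep x (↭-trans xs↭ (↭-prep (σ x) ys↭))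
        |xs|≡ = xs↭ys⇒|xs|≡|ys| (↭-trans xs↭ (↭-prep (σ x) ys↭))
        |zs|≤n = ℕ.≤-trans (ℕ.m≤n+m _ 2) (≡.subst (_≤ n) |xs|≡ |xs|≤n)
        all! = Unique-resp-↭ ↭₁ xs!
        x∈ : x ∈ x ∷ xs
        x∈ = here refl
        up : ∀ {z} → z ∈ zs → z ∈ x ∷ xs
        up z∈ = ∈-resp-↭ (↭-sym ↭₁) (there (there (there z∈)))
        D∈′ : ∀ {z} → z ∈ zs → D z
        D∈′ = D∈ ∘ up
        σ-inj : ∀ {z w} → z ∈ x ∷ xs → w ∈ x ∷ xs → σ z ≈ σ w → z ≈ w
        σ-inj z∈ w∈ σz≈σw = trans (sym (σ³≈id (D∈ z∈))) (trans
          (σ-cong (D∈ (σ∈ (σ∈ z∈))) (D∈ (σ∈ (σ∈ w∈))) (σ-cong (D∈ (σ∈ z∈)) (D∈ (σ∈ w∈)) σz≈σw))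
          (σ³≈id (D∈ w∈)))
        σ∈′ : ∀ {z} → z ∈ zs → σ z ∈ zs
        σ∈′ z∈ = ∈-tail (∈-tail (∈-tail (∈-resp-↭ ↭₁ (σ∈ (up z∈)))
          (λ σz≈x → ∉-tail (unique-tail (unique-tail all!)) z∈
            (σ-inj (up z∈) (σ∈ (σ∈ x∈)) (trans σz≈x (sym (σ³≈id (D∈ x∈)))))))
          (λ σz≈σx → ∉-tail all! (there (there z∈)) (σ-inj (up z∈) x∈ σz≈σx)))
          (λ σz≈σ²x → ∉-tail (unique-tail all!) (there z∈) (σ-inj (up z∈) (σ∈ x∈) σz≈σ²x))
      ... | divides q |zs|≡ = divides (suc q)
              (≡.cong suc (≡.trans (xs↭ys⇒|xs|≡|ys| (↭-trans xs↭ (↭-prep (σ x) ys↭))) (≡.cong (2 ℕ.+_) |zs|≡)))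

-- Inverses, cardinality and characteristic of the field.

module FieldProperties {c ℓ : Level} {m : ℕ} (F : FiniteField2^ m c ℓ) where
  open FiniteField2^ F hiding (zero)
  open Data.List.Membership.Setoid setoid using (_∈_)
  open Data.List.Relation.Unary.Unique.Setoid setoid using (Unique)
  open Data.List.Relation.Binary.Permutation.Setoid setoid using (_↭_)
  open Data.List.Relation.Binary.Permutation.Setoid.Properties setoid using (foldr-commMonoid; xs↭ys⇒|xs|≡|ys|)
  open UniqueLists setoid
  open Relation.Binary.Reasoning.Setoid setoid
  open Algebra.Properties.Semiring.Mult semiring using (×1-homo-*) renaming (_×_ to _·_)
  open Algebra.Properties.Ring ring using (+-cancelˡ; +-cancelʳ)

  1≉0 : ¬ (1# ≈ 0#)
  1≉0 = 0≉1 ∘ sym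

  *-cancelˡ : ∀ {x y z} → ¬ (x ≈ 0#) → x * y ≈ x * z → y ≈ z
  *-cancelˡ {x} {y} {z} x≉0 xy≈xz = begin
    y              ≈⟨ undo y ⟨
    x ⁻¹ * (x * y) ≈⟨ *-congˡ xy≈xz ⟩
    x ⁻¹ * (x * z) ≈⟨ undo z ⟩
    z              ∎
    where
    undo : ∀ w → x ⁻¹ * (x * w) ≈ w
    undo w = begin
      x ⁻¹ * (x * w) ≈⟨ *-assoc _ _ _ ⟨
      x ⁻¹ * x * w   ≈⟨ *-congʳ (trans (*-comm _ _) (inverseʳ x x≉0)) ⟩
      1# * w         ≈⟨ *-identityˡ w ⟩
      w              ∎

  *-cancelʳ : ∀ {x y z} → ¬ (x ≈ 0#) → y * x ≈ z * x → y ≈ z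
  *-cancelʳ x≉0 yx≈zx = *-cancelˡ x≉0 (trans (*-comm _ _) (trans yx≈zx (*-comm _ _)))

  x*y≈0⇒x≈0⊎y≈0 : ∀ {x y} → x * y ≈ 0# → x ≈ 0# ⊎ y ≈ 0#
  x*y≈0⇒x≈0⊎y≈0 {x} xy≈0 with x ≟ 0#
  ... | yes x≈0 = inj₁ x≈0
  ... | no  x≉0 = inj₂ (*-cancelˡ x≉0 (trans xy≈0 (sym (zeroʳ x))))

  *-≉0 : ∀ {x y} → ¬ (x ≈ 0#) → ¬ (y ≈ 0#) → ¬ (x * y ≈ 0#)
  *-≉0 x≉0 y≉0 xy≈0 with x*y≈0⇒x≈0⊎y≈0 xy≈0
  ... | inj₁ x≈0 = x≉0 x≈0
  ... | inj₂ y≈0 = y≉0 y≈0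

  x*y≈1⇒x≉0 : ∀ {x y} → x * y ≈ 1# → ¬ (x ≈ 0#)
  x*y≈1⇒x≉0 {x} {y} xy≈1 x≈0 = 1≉0 (trans (sym xy≈1) (trans (*-congʳ x≈0) (zeroˡ y)))

  x*y≈1⇒y≈x⁻¹ : ∀ {x y} → x * y ≈ 1# → y ≈ x ⁻¹
  x*y≈1⇒y≈x⁻¹ {x} xy≈1 = *-cancelˡ x≉0 (trans xy≈1 (sym (inverseʳ x x≉0)))
    where x≉0 = x*y≈1⇒x≉0 xy≈1

  ⁻¹-≉0 : ∀ {x} → ¬ (x ≈ 0#) → ¬ (x ⁻¹ ≈ 0#)
  ⁻¹-≉0 {x} x≉0 = x*y≈1⇒x≉0 (trans (*-comm _ x) (inverseʳ x x≉0))

  -- The operation `_⁻¹` is given as a bare function on the carrier; compatibility with `≈` follows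
  -- from uniqueness of inverses, hence away from zero.
  ⁻¹-cong : ∀ {x y} → ¬ (x ≈ 0#) → x ≈ y → x ⁻¹ ≈ y ⁻¹
  ⁻¹-cong {x} x≉0 x≈y = x*y≈1⇒y≈x⁻¹ (trans (*-congʳ (sym x≈y)) (inverseʳ x x≉0))

  ∈-nonzero : ∀ {x} → ¬ (x ≈ 0#) → x ∈ nonzero
  ∈-nonzero {x} x≉0 = ∈-filter⁺ _ (complete x) (λ x≈y y≈0 → x≉0 (trans x≈y y≈0))

  nonzero⇒≉0 : ∀ {x} → x ∈ nonzero → ¬ (x ≈ 0#)
  nonzero⇒≉0 x∈ x≈0 with _ , y , x≈y , y≉0 ← ∈-filter⁻ _ elements x∈ = y≉0 (trans (sym x≈y) x≈0)

  nonzero! : Unique nonzero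
  nonzero! = Unique.filter⁺ setoid _ unique

  1+|nonzero|≡2^m : suc (length nonzero) ≡ 2 ℕ.^ m
  1+|nonzero|≡2^m = ≡.trans (≡.sym (xs↭ys⇒|xs|≡|ys| elements↭)) card
    where
    0≉nonzero : All (λ y → ¬ (0# ≈ y)) nonzero
    0≉nonzero = All.tabulateₛ setoid λ y∈ 0≈y → nonzero⇒≉0 y∈ (sym 0≈y)

    ⊆-0∷nonzero : ∀ {x} → x ∈ elements → x ∈ 0# ∷ nonzero
    ⊆-0∷nonzero {x} _ with x ≟ 0#
    ... | yes x≈0 = here x≈0
    ... | no  x≉0 = there (∈-nonzero x≉0)

    elements↭ : elements ↭ 0# ∷ nonzero
    elements↭ = same-elements⇒↭ unique (0≉nonzero ∷ nonzero!) ⊆-0∷nonzero (λ {x} _ → complete x)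

  -- Translating all elements by 1 does not change their sum, so 2^m = 0 in F.
  1+1≈0 : 1# + 1# ≈ 0#
  1+1≈0 = 2^n≈0 m (≡.subst (λ n → n · 1# ≈ 0#) card
            (+-cancelˡ _ _ _ (trans (sym (sum-map elements)) (trans (foldr-commMonoid +-isCommutativeMonoid shifted) (sym (+-identityʳ _))))))
    where
    sum-map : ∀ xs → foldr _+_ 0# (map (_+ 1#) xs) ≈ foldr _+_ 0# xs + length xs · 1#
    sum-map []       = sym (+-identityʳ 0#)
    sum-map (x ∷ xs) = begin
      (x + 1#) + foldr _+_ 0# (map (_+ 1#) xs)           ≈⟨ +-congˡ (sum-map xs) ⟩
      (x + 1#) + (foldr _+_ 0# xs + length xs · 1#)      ≈⟨ +-assoc _ _ _ ⟩
      x + (1# + (foldr _+_ 0# xs + length xs · 1#))      ≈⟨ +-congˡ (+-assoc _ _ _) ⟨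
      x + ((1# + foldr _+_ 0# xs) + length xs · 1#)      ≈⟨ +-congˡ (+-congʳ (+-comm _ _)) ⟩
      x + ((foldr _+_ 0# xs + 1#) + length xs · 1#)      ≈⟨ +-congˡ (+-assoc _ _ _) ⟩
      x + (foldr _+_ 0# xs + (1# + length xs · 1#))      ≈⟨ +-assoc _ _ _ ⟨
      (x + foldr _+_ 0# xs) + (1# + length xs · 1#)      ∎

    ∈-shifted : ∀ {x} → x ∈ elements → x ∈ map (_+ 1#) elements
    ∈-shifted {x} _ = Membership.∈-resp-≈ setoid
      (trans (+-assoc _ _ _) (trans (+-congˡ (-‿inverseˡ 1#)) (+-identityʳ x)))
      (Membership.∈-map⁺ setoid setoid +-congʳ (complete (x + - 1#)))

    shifted : map (_+ 1#) elements ↭ elements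
    shifted = same-elements⇒↭ (Unique.map⁺ setoid setoid (+-cancelʳ _ _ _) unique) unique (λ {x} _ → complete x) ∈-shifted

    -- Without zero divisors, one factor 2 at a time can be split off until either 2 = 0 or the
    -- absurd 1 = 0 is reached.
    2^n≈0 : ∀ n → (2 ℕ.^ n) · 1# ≈ 0# → 1# + 1# ≈ 0#
    2^n≈0 zero    1+0≈0 = contradiction (trans (sym (+-identityʳ 1#)) 1+0≈0) 1≉0
    2^n≈0 (suc n) 2^≈0 with x*y≈0⇒x≈0⊎y≈0 (trans (sym (×1-homo-* 2 (2 ℕ.^ n))) 2^≈0)
    ... | inj₁ 1+1+0≈0 = trans (+-congˡ (sym (+-identityʳ 1#))) 1+1+0≈0
    ... | inj₂ 2^n·1≈0 = 2^n≈0 n 2^n·1≈0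

  x+x≈0 : ∀ x → x + x ≈ 0#
  x+x≈0 x = begin
    x + x           ≈⟨ +-cong (*-identityˡ x) (*-identityˡ x) ⟨
    1# * x + 1# * x ≈⟨ distribʳ x 1# 1# ⟨
    (1# + 1#) * x   ≈⟨ *-congʳ 1+1≈0 ⟩
    0# * x          ≈⟨ zeroˡ x ⟩
    0#              ∎

  x+y≈0⇒x≈y : ∀ {x y} → x + y ≈ 0# → x ≈ y
  x+y≈0⇒x≈y {x} {y} x+y≈0 = +-cancelʳ y x y (trans x+y≈0 (sym (x+x≈0 y)))

  -x≈x : ∀ x → - x ≈ x
  -x≈x x = +-cancelʳ x (- x) x (trans (-‿inverseˡ x) (sym (x+x≈0 x)))

  -- Coefficients for the ring solver, which thereby cancels equal terms in pairs.
  𝔽₂ : RawRing _ _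
  𝔽₂ = record { Carrier = Bool ; _≈_ = _≡_ ; _+_ = _xor_ ; _*_ = _∧_ ; -_ = λ b → b ; 0# = false ; 1# = true }

  𝔽₂⟶F : 𝔽₂ -Raw-AlmostCommutative⟶ fromCommutativeRing commRing
  𝔽₂⟶F = record
    { ⟦_⟧    = λ b → Bool.if b then 1# else 0#
    ; +-homo = λ where
        false _     → sym (+-identityˡ _)
        true  false → sym (+-identityʳ _)
        true  true  → sym 1+1≈0
    ; *-homo = λ where
        false _ → sym (zeroˡ _)
        true  _ → sym (*-identityˡ _)
    ; -‿homo = λ _ → sym (-x≈x _)
    ; 0-homo = refl
    ; 1-homo = refl
    }

  𝔽₂-≟ : WeaklyDecidable λ b b′ → (Bool.if b then 1# else 0#) ≈ (Bool.if b′ then 1# else 0#)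
  𝔽₂-≟ false false = just refl
  𝔽₂-≟ true  true  = just refl
  𝔽₂-≟ _     _     = nothing

  module Char2Solver = Algebra.Solver.Ring 𝔽₂ (fromCommutativeRing commRing) 𝔽₂⟶F 𝔽₂-≟
  open Char2Solver using (solve; con; _:+_; _:*_; _:=_)

  -- Powers, the Frobenius map and Fermat's theorem.

  pow-cong : ∀ n {x y} → x ≈ y → pow x n ≈ pow y n
  pow-cong zero    _   = refl
  pow-cong (suc n) x≈y = *-cong x≈y (pow-cong n x≈y)

  pow-+ : ∀ x n n′ → pow x (n ℕ.+ n′) ≈ pow x n * pow x n′
  pow-+ x zero    n′ = sym (*-identityˡ _)
  pow-+ x (suc n) n′ = trans (*-congˡ (pow-+ x n n′)) (sym (*-assoc _ _ _))

  pow-* : ∀ x y n → pow (x * y) n ≈ pow x n * pow y n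
  pow-* x y zero    = sym (*-identityˡ 1#)
  pow-* x y (suc n) = trans (*-congˡ (pow-* x y n))
    (solve 4 (λ x y p q → x :* y :* (p :* q) := x :* p :* (y :* q)) refl x y _ _)

  pow-2^suc : ∀ x n → pow x (2 ℕ.^ suc n) ≈ pow x (2 ℕ.^ n) * pow x (2 ℕ.^ n)
  pow-2^suc x n = ≡.subst (λ k → pow x (2 ℕ.^ n ℕ.+ k) ≈ pow x (2 ℕ.^ n) * pow x (2 ℕ.^ n))
    (≡.sym (ℕ.+-identityʳ _)) (pow-+ x (2 ℕ.^ n) (2 ℕ.^ n))

  pow-2^-+ : ∀ x y n → pow (x + y) (2 ℕ.^ n) ≈ pow x (2 ℕ.^ n) + pow y (2 ℕ.^ n)
  pow-2^-+ x y zero    = distribʳ 1# x y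
  pow-2^-+ x y (suc n) = begin
    pow (x + y) (2 ℕ.^ suc n)                   ≈⟨ pow-2^suc (x + y) n ⟩
    pow (x + y) (2 ℕ.^ n) * pow (x + y) (2 ℕ.^ n) ≈⟨ *-cong (pow-2^-+ x y n) (pow-2^-+ x y n) ⟩
    (p + q) * (p + q)                           ≈⟨ solve 2 (λ p q → (p :+ q) :* (p :+ q) := p :* p :+ q :* q) refl p q ⟩
    p * p + q * q                               ≈⟨ +-cong (pow-2^suc x n) (pow-2^suc y n) ⟨
    pow x (2 ℕ.^ suc n) + pow y (2 ℕ.^ suc n)   ∎
    where
    p = pow x (2 ℕ.^ n)
    q = pow y (2 ℕ.^ n)

  scaling-↭ : ∀ {x} → ¬ (x ≈ 0#) → map (x *_) nonzero ↭ nonzero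
  scaling-↭ {x} x≉0 = same-elements⇒↭ (Unique.map⁺ setoid setoid (*-cancelˡ x≉0) nonzero!) nonzero! ⊆-nonzero ⊇-nonzero
    where
    ⊆-nonzero : ∀ {z} → z ∈ map (x *_) nonzero → z ∈ nonzero
    ⊆-nonzero z∈ with y , y∈ , z≈xy ← Membership.∈-map⁻ setoid setoid z∈ =
      ∈-nonzero λ z≈0 → *-≉0 x≉0 (nonzero⇒≉0 y∈) (trans (sym z≈xy) z≈0)

    ⊇-nonzero : ∀ {z} → z ∈ nonzero → z ∈ map (x *_) nonzero
    ⊇-nonzero {z} z∈ = Membership.∈-resp-≈ setoid
      (trans (sym (*-assoc _ _ _)) (trans (*-congʳ (inverseʳ x x≉0)) (*-identityˡ z)))
      (Membership.∈-map⁺ setoid setoid *-congˡ (∈-nonzero (*-≉0 (⁻¹-≉0 x≉0) (nonzero⇒≉0 z∈))))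

  -- Multiplication by `x` permutes the nonzero elements; comparing the products before and after,
  -- and cancelling the nonzero product, leaves the power of `x`.
  pow-|nonzero| : ∀ {x} → ¬ (x ≈ 0#) → pow x (length nonzero) ≈ 1#
  pow-|nonzero| {x} x≉0 = *-cancelʳ (product≉0 nonzero nonzero⇒≉0) (begin
    pow x (length nonzero) * foldr _*_ 1# nonzero ≈⟨ product-map nonzero ⟨
    foldr _*_ 1# (map (x *_) nonzero)             ≈⟨ foldr-commMonoid *-isCommutativeMonoid (scaling-↭ x≉0) ⟩
    foldr _*_ 1# nonzero                          ≈⟨ *-identityˡ _ ⟨
    1# * foldr _*_ 1# nonzero                     ∎)
    where
    product-map : ∀ ys → foldr _*_ 1# (map (x *_) ys) ≈ pow x (length ys) * foldr _*_ 1# ys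
    product-map []       = sym (*-identityˡ 1#)
    product-map (y ∷ ys) = trans (*-congˡ (product-map ys))
      (solve 4 (λ x y p q → x :* y :* (p :* q) := x :* p :* (y :* q)) refl x y _ _)

    product≉0 : ∀ ys → (∀ {y} → y ∈ ys → ¬ (y ≈ 0#)) → ¬ (foldr _*_ 1# ys ≈ 0#)
    product≉0 []       _   = 1≉0
    product≉0 (y ∷ ys) ys≉0 = *-≉0 (ys≉0 (here refl)) (product≉0 ys (ys≉0 ∘ there))

  pow-2^m : ∀ x → pow x (2 ℕ.^ m) ≈ x
  pow-2^m x rewrite ≡.sym 1+|nonzero|≡2^m with x ≟ 0#
  ... | yes x≈0 = trans (*-congʳ x≈0) (trans (zeroˡ _) (sym x≈0))
  ... | no  x≉0 = trans (*-congˡ (pow-|nonzero| x≉0)) (*-identityʳ x)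

  -- Roots of polynomials.

  y²+y-injective : ∀ {y z} → y * y + y ≈ z * z + z → y ≈ z ⊎ y ≈ z + 1#
  y²+y-injective {y} {z} eq with x*y≈0⇒x≈0⊎y≈0 (begin
    (y + z) * (y + (z + 1#))      ≈⟨ solve 2 (λ y z → (y :+ z) :* (y :+ (z :+ con true)) := (y :* y :+ y) :+ (z :* z :+ z)) refl y z ⟩
    (y * y + y) + (z * z + z)     ≈⟨ +-congʳ eq ⟩
    (z * z + z) + (z * z + z)     ≈⟨ x+x≈0 _ ⟩
    0#                            ∎)
  ... | inj₁ y+z≈0   = inj₁ (x+y≈0⇒x≈y y+z≈0)
  ... | inj₂ y+z+1≈0 = inj₂ (x+y≈0⇒x≈y y+z+1≈0)

  square-injective : ∀ {y z} → y * y ≈ z * z → y ≈ z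
  square-injective {y} {z} eq with x*y≈0⇒x≈0⊎y≈0 (begin
    (y + z) * (y + z)  ≈⟨ solve 2 (λ y z → (y :+ z) :* (y :+ z) := y :* y :+ z :* z) refl y z ⟩
    y * y + z * z      ≈⟨ +-congʳ eq ⟩
    z * z + z * z      ≈⟨ x+x≈0 _ ⟩
    0#                 ∎)
  ... | inj₁ y+z≈0 = x+y≈0⇒x≈y y+z≈0
  ... | inj₂ y+z≈0 = x+y≈0⇒x≈y y+z≈0

  -- eval l (c₀ ∷ … ∷ c_{d-1}) x is c₀ + c₁ x + … + c_{d-1} x^{d-1} + l x^d.
  eval : ∀ {d} → Carrier → Vec Carrier d → Carrier → Carrier
  eval l []       x = l
  eval l (c ∷ cs) x = c + x * eval l cs x

  -- Synthetic division by x + r: the coefficients are the Horner tails evaluated at `r`, and the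
  -- leading coefficient stays `l`.
  quotient : ∀ {d} → Carrier → Vec Carrier (suc d) → Carrier → Vec Carrier d
  quotient l (_ ∷ [])          r = []
  quotient l (_ ∷ cs@(_ ∷ _)) r = eval l cs r ∷ quotient l cs r

  eval-quotient : ∀ {d} l (cs : Vec Carrier (suc d)) r x →
                  eval l cs x + eval l cs r ≈ (x + r) * eval l (quotient l cs r) x
  eval-quotient l (c ∷ []) r x =
    solve 4 (λ c x l r → (c :+ x :* l) :+ (c :+ r :* l) := (x :+ r) :* l) refl c x l r
  eval-quotient l (c ∷ cs@(_ ∷ _)) r x = begin
    (c + x * f) + (c + r * g)     ≈⟨ solve 5 (λ c x f r g → (c :+ x :* f) :+ (c :+ r :* g) := (x :+ r) :* g :+ x :* (f :+ g)) refl c x f r g ⟩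
    (x + r) * g + x * (f + g)     ≈⟨ +-congˡ (*-congˡ (eval-quotient l cs r x)) ⟩
    (x + r) * g + x * ((x + r) * h) ≈⟨ solve 4 (λ x r g h → (x :+ r) :* g :+ x :* ((x :+ r) :* h) := (x :+ r) :* (g :+ x :* h)) refl x r g h ⟩
    (x + r) * (g + x * h)         ∎
    where
    f = eval l cs x
    g = eval l cs r
    h = eval l (quotient l cs r) x

  -- Splitting off the factor of the first root `r` lowers the degree by one, and every root
  -- different from `r` is a root of the quotient.
  |roots|≤degree : ∀ {d l} (cs : Vec Carrier d) → ¬ (l ≈ 0#) → ∀ {xs} → Unique xs →
                   All (λ x → eval l cs x ≈ 0#) xs → length xs ≤ d
  |roots|≤degree _  _ {[]} _ _ = z≤n
  |roots|≤degree [] l≉0 {_ ∷ _} _ (l≈0 ∷ _) = contradiction l≈0 l≉0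
  |roots|≤degree {l = l} cs@(_ ∷ _) l≉0 {r ∷ _} (r≉xs ∷ xs!) (fr≈0 ∷ fxs≈0) =
    s≤s (|roots|≤degree (quotient l cs r) l≉0 xs! (All.zipWith root (r≉xs , fxs≈0)))
    where
    root : ∀ {x} → ¬ (r ≈ x) × eval l cs x ≈ 0# → eval l (quotient l cs r) x ≈ 0#
    root {x} (r≉x , fx≈0) with x*y≈0⇒x≈0⊎y≈0 (trans (sym (eval-quotient l cs r x)) (trans (+-cong fx≈0 fr≈0) (+-identityʳ 0#)))
    ... | inj₁ x+r≈0 = contradiction (sym (x+y≈0⇒x≈y x+r≈0)) r≉x
    ... | inj₂ q≈0   = q≈0

  eval-zipWith : ∀ {d} l l′ (cs cs′ : Vec Carrier d) x →
                 eval (l + l′) (zipWith _+_ cs cs′) x ≈ eval l cs x + eval l′ cs′ x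
  eval-zipWith l l′ []       []         x = refl
  eval-zipWith l l′ (c ∷ cs) (c′ ∷ cs′) x = trans (+-congˡ (*-congˡ (eval-zipWith l l′ cs cs′ x)))
    (solve 5 (λ c c′ x f g → (c :+ c′) :+ x :* (f :+ g) := (c :+ x :* f) :+ (c′ :+ x :* g)) refl c c′ x _ _)

  eval-replicate : ∀ d x → eval 1# (replicate d 0#) x ≈ pow x d
  eval-replicate zero    x = refl
  eval-replicate (suc d) x = trans (+-identityˡ _) (*-congˡ (eval-replicate d x))

-- Partial traces and additive Hilbert 90.

module PartialTrace {c ℓ : Level} {m : ℕ} (F : FiniteField2^ m c ℓ) where
  open FiniteField2^ F hiding (zero)
  open FieldProperties F
  open Char2Solver using (solve; con; _:+_; _:*_; _:=_)
  open Relation.Binary.Reasoning.Setoid setoid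

  T : ℕ → Carrier → Carrier
  T zero    x = 0#
  T (suc n) x = pow x (2 ℕ.^ n) + T n x

  -- Serves to identify the local recursion inside `Tr`, which is accessible only through its two
  -- defining equations.
  T-unique : ∀ x (g : ℕ → Carrier) → g 0 ≡ 0# → (∀ n → g (suc n) ≡ pow x (2 ℕ.^ n) + g n) →
             ∀ n → g n ≡ T n x
  T-unique x g g0 gsuc zero    = g0
  T-unique x g g0 gsuc (suc n) = ≡.trans (gsuc n) (≡.cong (_+_ (pow x (2 ℕ.^ n))) (T-unique x g g0 gsuc n))

  T-cong : ∀ n {x y} → x ≈ y → T n x ≈ T n y
  T-cong zero    _   = refl
  T-cong (suc n) x≈y = +-cong (pow-cong (2 ℕ.^ n) x≈y) (T-cong n x≈y)

  T-+ : ∀ n x y → T n (x + y) ≈ T n x + T n y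
  T-+ zero    x y = sym (+-identityʳ 0#)
  T-+ (suc n) x y = trans (+-cong (pow-2^-+ x y n) (T-+ n x y))
    (solve 4 (λ p q s t → (p :+ q) :+ (s :+ t) := (p :+ s) :+ (q :+ t)) refl _ _ _ _)

  T-square : ∀ n x → T n (x * x) ≈ T n x * T n x
  T-square zero    x = sym (zeroʳ 0#)
  T-square (suc n) x = trans (+-cong (pow-* x x (2 ℕ.^ n)) (T-square n x))
    (solve 2 (λ p t → p :* p :+ t :* t := (p :+ t) :* (p :+ t)) refl _ _)

  -- Squaring moves each summand to the next one, so compared with `T (suc n) x` exactly the first
  -- summand `x` is missing.
  T² : ∀ n x → T n x * T n x ≈ T (suc n) x + x
  T² zero    x = begin
    0# * 0#               ≈⟨ zeroʳ 0# ⟩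
    0#                    ≈⟨ solve 1 (λ x → con false := (x :* con true :+ con false) :+ x) refl x ⟩
    (x * 1# + 0#) + x     ∎
  T² (suc n) x = begin
    (p + t) * (p + t)                  ≈⟨ solve 2 (λ p t → (p :+ t) :* (p :+ t) := p :* p :+ t :* t) refl p t ⟩
    p * p + t * t                      ≈⟨ +-cong (sym (pow-2^suc x n)) (T² n x) ⟩
    pow x (2 ℕ.^ suc n) + ((p + t) + x) ≈⟨ +-assoc _ _ _ ⟨
    T (suc (suc n)) x + x              ∎
    where
    p = pow x (2 ℕ.^ n)
    t = T n x

  -- A formal leading coefficient zero allows any larger degree: the true leading coefficient
  -- becomes an ordinary entry, followed by zeros.
  pad : ∀ {d e} l (cs : Vec Carrier d) → d ℕ.< e →
        ∃ λ (cs′ : Vec Carrier e) → ∀ x → eval 0# cs′ x ≈ eval l cs x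
  pad {e = suc e} l [] _ = l ∷ replicate e 0# , λ x → trans (+-congˡ (trans (*-congˡ (eval-0 e x)) (zeroʳ x))) (+-identityʳ l)
    where
    eval-0 : ∀ e x → eval 0# (replicate e 0#) x ≈ 0#
    eval-0 zero    x = refl
    eval-0 (suc e) x = trans (+-congˡ (trans (*-congˡ (eval-0 e x)) (zeroʳ x))) (+-identityʳ 0#)
  pad l (c ∷ cs) (s≤s d<e) =
    let cs′ , eq = pad l cs d<e in c ∷ cs′ , λ x → +-congˡ (*-congˡ (eq x))

  -- The top summand has degree 2^n, while `T n` has smaller degree and can be padded to length 2^n.
  -- The leading coefficient is spelled `1# + 0#` because the two polynomials are added entrywise.
  T-monic : ∀ n → ∃ λ (cs : Vec Carrier (2 ℕ.^ n)) → ∀ x → eval (1# + 0#) cs x ≈ T (suc n) x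
  T-monic n = let cs , eq = T-degree n in zipWith _+_ (replicate (2 ℕ.^ n) 0#) cs , λ x →
    trans (eval-zipWith 1# 0# (replicate (2 ℕ.^ n) 0#) cs x) (+-cong (eval-replicate (2 ℕ.^ n) x) (eq x))
    where
    T-degree : ∀ n → ∃ λ (cs : Vec Carrier (2 ℕ.^ n)) → ∀ x → eval 0# cs x ≈ T n x
    T-degree zero    = 0# ∷ [] , λ x → trans (+-congˡ (zeroʳ x)) (+-identityʳ 0#)
    T-degree (suc n) =
      let cs , eq   = T-monic n
          cs′ , eq′ = pad (1# + 0#) cs (ℕ.^-monoʳ-< 2 (s≤s (s≤s z≤n)) (ℕ.n<1+n n))
      in cs′ , λ x → trans (eq′ x) (eq x)

  -- Additive Hilbert 90: if Tr θ = 1 and Tr t = 0, then y = hilbert θ t m solves y² + y = t.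
  hilbert : Carrier → Carrier → ℕ → Carrier
  hilbert θ t zero    = 0#
  hilbert θ t (suc n) = pow θ (2 ℕ.^ n) * T n t + hilbert θ t n

  -- Induction on `n`: by `T²` the square of the new summand is θ^(2^(n+1)) (T (n+1) t + t), while
  -- the unsquared summand cancels a term of the previous right-hand side. The multiples of `t`
  -- collect to the square of `T n θ`.
  hilbert-y²+y : ∀ θ t n → hilbert θ t n * hilbert θ t n + hilbert θ t n ≈
                           pow θ (2 ℕ.^ n) * T n t + t * (T n θ * T n θ)
  hilbert-y²+y θ t zero =
    solve 2 (λ θ t → con false :* con false :+ con false := (θ :* con true) :* con false :+ t :* (con false :* con false)) refl θ t
  hilbert-y²+y θ t (suc n) = begin
    (p * s + h) * (p * s + h) + (p * s + h)
      ≈⟨ solve 3 (λ p s h → (p :* s :+ h) :* (p :* s :+ h) :+ (p :* s :+ h) := (p :* p) :* (s :* s) :+ (p :* s :+ (h :* h :+ h))) refl p s h ⟩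
    (p * p) * (s * s) + (p * s + (h * h + h))
      ≈⟨ +-cong (*-cong (sym (pow-2^suc θ n)) (T² n t)) (+-congˡ (hilbert-y²+y θ t n)) ⟩
    q * (T (suc n) t + t) + (p * s + (p * s + t * (u * u)))
      ≈⟨ solve 5 (λ q r t ps uu → q :* (r :+ t) :+ (ps :+ (ps :+ t :* uu)) := q :* r :+ t :* (q :+ uu)) refl q (T (suc n) t) t (p * s) (u * u) ⟩
    q * T (suc n) t + t * (q + u * u)
      ≈⟨ +-congˡ (*-congˡ (+-congʳ (pow-2^suc θ n))) ⟩
    q * T (suc n) t + t * (p * p + u * u)
      ≈⟨ +-congˡ (*-congˡ (solve 2 (λ p u → p :* p :+ u :* u := (p :+ u) :* (p :+ u)) refl p u)) ⟩
    q * T (suc n) t + t * ((p + u) * (p + u))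
      ∎
    where
    p = pow θ (2 ℕ.^ n)
    q = pow θ (2 ℕ.^ suc n)
    s = T n t
    u = T n θ
    h = hilbert θ t n

-- Identification of the absolute trace with a partial trace.

data IsCong {a b} {A : Set a} {B : Set b} (f : A → B) {x y : A} (e : x ≡ y) : {v w : B} → v ≡ w → Set (a ⊔ b) where
  isCong : IsCong f e (≡.cong f e)

-- Checking `isCong` forces the proof `q e` to be literally `≡.cong f e`, so unification determines
-- the implicit `f`, which is then returned.
uncong : ∀ {a b} {A : Set a} {B : Set b} {x y : A} {v w : B} {q : x ≡ y → v ≡ w} {f : A → B} →
         (∀ e → IsCong f e (q e)) → A → B
uncong {f = f} _ = f

-- Tr x is g m for a local function g that cannot be named from outside its definition.
-- For m = 2 + k, unfolding Tr x twice exposes the terms g (1 + k) and g k;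
-- cong! anti-unifies them to λ n → g n, and uncong reads this function back
-- from the resulting proof (whose hypothesis 1 + k ≡ k is never used).
module UnfoldTrace {c ℓ : Level} {k : ℕ} (F : FiniteField2^ (suc (suc k)) c ℓ) where
  open FiniteField2^ F using (Carrier; _+_; Tr)
  open PartialTrace F

  private
    -- An identity function whose two equations, supplied as `≡.refl`, let unification find the
    -- tails `v` and `v′` of two successive unfoldings.
    tails : ∀ {w u v u′ v′ : Carrier} {n n′ : ℕ} → w ≡ u + v → v ≡ u′ + v′ → (n ≡ n′ → v ≡ v′) → n ≡ n′ → v ≡ v′
    tails _ _ f = f

    tails-cong : ∀ x → suc k ≡ k → _
    tails-cong x = tails {w = Tr x} ≡.refl ≡.refl (λ e → cong! e)

  Tr≡T : ∀ x → Tr x ≡ T (suc (suc k)) x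
  Tr≡T x = T-unique x (uncong {q = tails-cong x} (λ e → isCong)) ≡.refl (λ _ → ≡.refl) (suc (suc k))

-- Properties of the absolute trace.

module Trace {c ℓ : Level} {m n : ℕ} (F : FiniteField2^ m c ℓ) (m≡1+n : m ≡ suc n)
  (Tr≡T : ∀ x → FiniteField2^.Tr F x ≡ PartialTrace.T F m x) where
  open FiniteField2^ F hiding (zero)
  open FieldProperties F
  open PartialTrace F
  open Char2Solver using (solve; con; _:+_; _:*_; _:=_)
  open Relation.Binary.Reasoning.Setoid setoid

  Tr-cong : ∀ {x y} → x ≈ y → Tr x ≈ Tr y
  Tr-cong {x} {y} x≈y rewrite Tr≡T x | Tr≡T y = T-cong m x≈y

  Tr-+ : ∀ x y → Tr (x + y) ≈ Tr x + Tr y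
  Tr-+ x y rewrite Tr≡T (x + y) | Tr≡T x | Tr≡T y = T-+ m x y

  -- In `T²` for n = m the new top summand is x^(2^m) = x, which cancels the extra `x`.
  Tr-idem : ∀ x → Tr x * Tr x ≈ Tr x
  Tr-idem x rewrite Tr≡T x = begin
    T m x * T m x                     ≈⟨ T² m x ⟩
    (pow x (2 ℕ.^ m) + T m x) + x     ≈⟨ +-congʳ (+-congʳ (pow-2^m x)) ⟩
    (x + T m x) + x                   ≈⟨ solve 2 (λ x t → (x :+ t) :+ x := t) refl x (T m x) ⟩
    T m x                             ∎

  Tr-square : ∀ x → Tr (x * x) ≈ Tr x
  Tr-square x = trans square (Tr-idem x)
    where
    square : Tr (x * x) ≈ Tr x * Tr x
    square rewrite Tr≡T (x * x) | Tr≡T x = T-square m x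

  Tr≈0⊎Tr≈1 : ∀ x → Tr x ≈ 0# ⊎ Tr x ≈ 1#
  Tr≈0⊎Tr≈1 x with x*y≈0⇒x≈0⊎y≈0 (begin
    Tr x * (Tr x + 1#)     ≈⟨ solve 1 (λ t → t :* (t :+ con true) := t :* t :+ t) refl (Tr x) ⟩
    Tr x * Tr x + Tr x     ≈⟨ +-congʳ (Tr-idem x) ⟩
    Tr x + Tr x            ≈⟨ x+x≈0 _ ⟩
    0#                     ∎)
  ... | inj₁ t≈0   = inj₁ t≈0
  ... | inj₂ t+1≈0 = inj₂ (x+y≈0⇒x≈y t+1≈0)

  Tr≉0⇒Tr≈1 : ∀ {x} → ¬ (Tr x ≈ 0#) → Tr x ≈ 1#
  Tr≉0⇒Tr≈1 {x} t≉0 with Tr≈0⊎Tr≈1 x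
  ... | inj₁ t≈0 = contradiction t≈0 t≉0
  ... | inj₂ t≈1 = t≈1

  -- The easy direction of additive Hilbert 90; `solution-y²+y` is the other one.
  Tr-y²+y : ∀ y → Tr (y * y + y) ≈ 0#
  Tr-y²+y y = trans (Tr-+ _ _) (trans (+-congʳ (Tr-square y)) (x+x≈0 _))

  -- Otherwise the 2^m elements of F would be roots of a monic polynomial of degree 2^(m-1).
  ∃Tr≈1 : ∃ λ θ → Tr θ ≈ 1#
  ∃Tr≈1 with Any.any? (λ x → Tr x ≟ 1#) elements
  ... | yes any = Any.satisfied any
  ... | no none = contradiction 2^m≤2^n (ℕ.<⇒≱ (ℕ.^-monoʳ-< 2 (s≤s (s≤s z≤n)) (≡.subst (n ℕ.<_) (≡.sym m≡1+n) (ℕ.n<1+n n))))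
    where
    cs = proj₁ (T-monic n)

    root : ∀ {x} → ¬ (Tr x ≈ 1#) → eval (1# + 0#) cs x ≈ 0#
    root {x} t≉1 with Tr≈0⊎Tr≈1 x
    ... | inj₁ t≈0 = trans (proj₂ (T-monic n) x) (≡.subst (_≈ 0#) (≡.trans (Tr≡T x) (≡.cong (λ m → T m x) m≡1+n)) t≈0)
    ... | inj₂ t≈1 = contradiction t≈1 t≉1

    2^m≤2^n : 2 ℕ.^ m ≤ 2 ℕ.^ n
    2^m≤2^n = ≡.subst (_≤ 2 ℕ.^ n) card
      (|roots|≤degree cs (1≉0 ∘ trans (sym (+-identityʳ 1#))) unique (All.map root (¬Any⇒All¬ elements none)))

  solution : Carrier → Carrier
  solution t = hilbert (proj₁ ∃Tr≈1) t m

  solution-y²+y : ∀ {t} → Tr t ≈ 0# → solution t * solution t + solution t ≈ t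
  solution-y²+y {t} Tr≈0 with θ , Trθ≈1 ← ∃Tr≈1 = begin
    hilbert θ t m * hilbert θ t m + hilbert θ t m  ≈⟨ hilbert-y²+y θ t m ⟩
    p * T m t + t * (T m θ * T m θ)                ≈⟨ +-cong (*-congˡ T≈0) (*-congˡ (*-cong Tθ≈1 Tθ≈1)) ⟩
    p * 0# + t * (1# * 1#)                         ≈⟨ solve 2 (λ p t → p :* con false :+ t :* (con true :* con true) := t) refl p t ⟩
    t                                              ∎
    where
    p = pow θ (2 ℕ.^ m)
    T≈0 = ≡.subst (_≈ 0#) (Tr≡T t) Tr≈0
    Tθ≈1 = ≡.subst (_≈ 1#) (Tr≡T θ) Trθ≈1

-- The cube root of unity and the subfield of order 4.

module CubeRoot {c ℓ : Level} {m : ℕ} (F : FiniteField2^ m c ℓ) (a : FiniteField2^.Carrier F)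
  (a≉0 : ¬ (FiniteField2^._≈_ F a (FiniteField2^.0# F)))
  (a≉1 : ¬ (FiniteField2^._≈_ F a (FiniteField2^.1# F)))
  (a³≈1 : FiniteField2^._≈_ F (FiniteField2^._*_ F (FiniteField2^._*_ F a a) a) (FiniteField2^.1# F)) where
  open FiniteField2^ F hiding (zero)
  open FieldProperties F
  open Char2Solver using (solve; con; _:+_; _:*_; _:=_)
  open UniqueLists setoid
  open Relation.Binary.Reasoning.Setoid setoid

  3∣|nonzero| : 3 ℕ.∣ length nonzero
  3∣|nonzero| = 3∣length σ³≈id nonzero nonzero! (nonzero⇒≉0 , (λ x∈ → ∈-nonzero (*-≉0 a≉0 (nonzero⇒≉0 x∈))))
    where
    open FreeAction (λ x → ¬ (x ≈ 0#)) (a *_) (λ _ _ → *-congˡ)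
      (λ x≉0 ax≈x → a≉1 (*-cancelʳ x≉0 (trans ax≈x (sym (*-identityˡ _)))))
    σ³≈id : ∀ {x} → ¬ (x ≈ 0#) → a * (a * (a * x)) ≈ x
    σ³≈id {x} _ = begin
      a * (a * (a * x)) ≈⟨ solve 2 (λ a x → a :* (a :* (a :* x)) := a :* a :* a :* x) refl a x ⟩
      a * a * a * x     ≈⟨ *-congʳ a³≈1 ⟩
      1# * x            ≈⟨ *-identityˡ x ⟩
      x                 ∎

  -- From a³ + 1 = (a + 1)(a² + a + 1), whose first factor is nonzero.
  a²≈a+1 : a * a ≈ a + 1#
  a²≈a+1 with x*y≈0⇒x≈0⊎y≈0 (begin
    (a + 1#) * (a * a + (a + 1#))  ≈⟨ solve 1 (λ a → (a :+ con true) :* (a :* a :+ (a :+ con true)) := a :* a :* a :+ con true) refl a ⟩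
    a * a * a + 1#                 ≈⟨ +-congʳ a³≈1 ⟩
    1# + 1#                        ≈⟨ 1+1≈0 ⟩
    0#                             ∎)
  ... | inj₁ a+1≈0    = contradiction (x+y≈0⇒x≈y a+1≈0) a≉1
  ... | inj₂ a²+a+1≈0 = x+y≈0⇒x≈y a²+a+1≈0

  -- (b , b′) stands for b + b′ a.
  𝔽₄ : RawRing _ _
  𝔽₄ = record
    { Carrier = Bool × Bool
    ; _≈_ = _≡_
    ; _+_ = λ (b , b′) (d , d′) → b xor d , b′ xor d′
    ; _*_ = λ (b , b′) (d , d′) → (b ∧ d) xor (b′ ∧ d′) , ((b ∧ d′) xor (b′ ∧ d)) xor (b′ ∧ d′)
    ; -_  = λ b → b
    ; 0#  = false , false
    ; 1#  = true , false
    }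

  ⟦_⟧₄ : Bool × Bool → Carrier
  ⟦ false , false ⟧₄ = 0#
  ⟦ true  , false ⟧₄ = 1#
  ⟦ false , true  ⟧₄ = a
  ⟦ true  , true  ⟧₄ = 1# + a

  𝔽₄⟶F : 𝔽₄ -Raw-AlmostCommutative⟶ fromCommutativeRing commRing
  𝔽₄⟶F = record
    { ⟦_⟧    = ⟦_⟧₄
    ; +-homo = +-homo
    ; *-homo = *-homo
    ; -‿homo = λ _ → sym (-x≈x _)
    ; 0-homo = refl
    ; 1-homo = refl
    }
    where
    +-homo : ∀ x y → ⟦ RawRing._+_ 𝔽₄ x y ⟧₄ ≈ ⟦ x ⟧₄ + ⟦ y ⟧₄
    +-homo (false , false) _             = sym (+-identityˡ _)
    +-homo (true  , false) (false , false) = sym (+-identityʳ _)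
    +-homo (true  , false) (true  , false) = sym 1+1≈0
    +-homo (true  , false) (false , true)  = refl
    +-homo (true  , false) (true  , true)  = solve 1 (λ a → a := con true :+ (con true :+ a)) refl a
    +-homo (false , true)  (false , false) = sym (+-identityʳ _)
    +-homo (false , true)  (true  , false) = +-comm _ _
    +-homo (false , true)  (false , true)  = sym (x+x≈0 a)
    +-homo (false , true)  (true  , true)  = solve 1 (λ a → con true := a :+ (con true :+ a)) refl a
    +-homo (true  , true)  (false , false) = sym (+-identityʳ _)
    +-homo (true  , true)  (true  , false) = solve 1 (λ a → a := (con true :+ a) :+ con true) refl a
    +-homo (true  , true)  (false , true)  = solve 1 (λ a → con true := (con true :+ a) :+ a) refl a
    +-homo (true  , true)  (true  , true)  = sym (x+x≈0 _)

    *-homo : ∀ x y → ⟦ RawRing._*_ 𝔽₄ x y ⟧₄ ≈ ⟦ x ⟧₄ * ⟦ y ⟧₄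
    *-homo (false , false) _               = sym (zeroˡ _)
    *-homo (true  , false) (false , false) = sym (zeroʳ _)
    *-homo (true  , false) (true  , false) = sym (*-identityˡ _)
    *-homo (true  , false) (false , true)  = sym (*-identityˡ _)
    *-homo (true  , false) (true  , true)  = sym (*-identityˡ _)
    *-homo (false , true)  (false , false) = sym (zeroʳ _)
    *-homo (false , true)  (true  , false) = sym (*-identityʳ _)
    *-homo (false , true)  (false , true)  = sym (trans a²≈a+1 (+-comm _ _))
    *-homo (false , true)  (true  , true)  = sym (begin
      a * (1# + a)    ≈⟨ solve 1 (λ a → a :* (con true :+ a) := a :+ a :* a) refl a ⟩
      a + a * a       ≈⟨ +-congˡ a²≈a+1 ⟩
      a + (a + 1#)    ≈⟨ solve 1 (λ a → a :+ (a :+ con true) := con true) refl a ⟩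
      1#              ∎)
    *-homo (true  , true)  (false , false) = sym (zeroʳ _)
    *-homo (true  , true)  (true  , false) = sym (*-identityʳ _)
    *-homo (true  , true)  (false , true)  = sym (begin
      (1# + a) * a    ≈⟨ solve 1 (λ a → (con true :+ a) :* a := a :+ a :* a) refl a ⟩
      a + a * a       ≈⟨ +-congˡ a²≈a+1 ⟩
      a + (a + 1#)    ≈⟨ solve 1 (λ a → a :+ (a :+ con true) := con true) refl a ⟩
      1#              ∎)
    *-homo (true  , true)  (true  , true)  = sym (begin
      (1# + a) * (1# + a) ≈⟨ solve 1 (λ a → (con true :+ a) :* (con true :+ a) := con true :+ a :* a) refl a ⟩
      1# + a * a          ≈⟨ +-congˡ a²≈a+1 ⟩
      1# + (a + 1#)       ≈⟨ solve 1 (λ a → con true :+ (a :+ con true) := a) refl a ⟩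
      a                   ∎)

  𝔽₄-≟ : WeaklyDecidable λ x y → ⟦ x ⟧₄ ≈ ⟦ y ⟧₄
  𝔽₄-≟ x y with Product.≡-dec Bool._≟_ Bool._≟_ x y
  ... | yes ≡.refl = just refl
  ... | no  _      = nothing

  -- With these coefficients the solver reduces powers of `a` by a² = a + 1, so identities special
  -- to this `a` are decided as well.
  module 𝔽₄Solver = Algebra.Solver.Ring 𝔽₄ (fromCommutativeRing commRing) 𝔽₄⟶F 𝔽₄-≟

-- Congruences modulo 4, 3 and 12.

module Arithmetic {K : ℤ} {N L : ℕ} (K+2N≡L : K ℤ.+ + (2 ℕ.* N) ≡ + L) where
  open ℤ.+-*-Solver using (solve; con; _:+_; _:-_; _:=_)
  open ≡.≡-Reasoning

  -- Here `N` counts the summands -1 and 1 + L = 2^m; the identity is K + 1 = (1 + L) - 2 N.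
  4∣K+1 : 2 ℕ.∣ N → 4 ℕ.∣ suc L → + 4 ∣ₛ K ℤ.+ + 1
  4∣K+1 2∣N 4∣1+L = ≡.subst (+ 4 ∣ₛ_) eq (∣m∣n⇒∣m-n {m = + suc L} {n = + (2 ℕ.* N)} (∣ᵤ⇒∣ 4∣1+L) (∣ᵤ⇒∣ (ℕ.*-monoʳ-∣ 2 2∣N)))
    where
    eq : + suc L ℤ.- + (2 ℕ.* N) ≡ K ℤ.+ + 1
    eq = begin
      + 1 ℤ.+ + L ℤ.- + (2 ℕ.* N)                        ≡⟨ ≡.cong (λ l → + 1 ℤ.+ l ℤ.- + (2 ℕ.* N)) K+2N≡L ⟨
      + 1 ℤ.+ (K ℤ.+ + (2 ℕ.* N)) ℤ.- + (2 ℕ.* N)        ≡⟨ solve 2 (λ K n → con (+ 1) :+ (K :+ n) :- n := K :+ con (+ 1)) ≡.refl K (+ (2 ℕ.* N)) ⟩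
      K ℤ.+ + 1                                          ∎

  -- Here 1 + v is the number W of solvable abscissae and 1 + 2 v the number of curve points.
  -- Eliminating `N` gives K - 1 = (1 + 2 v) - L.
  3∣K-1 : ∀ {v} → 3 ℕ.∣ L → 3 ℕ.∣ suc (2 ℕ.* v) → suc v ℕ.+ N ≡ L → + 3 ∣ₛ K ℤ.- + 1
  3∣K-1 {v} 3∣L 3∣1+2v 1+v+N≡L = ≡.subst (+ 3 ∣ₛ_) eq (∣m∣n⇒∣m-n {m = + suc (2 ℕ.* v)} {n = + L} (∣ᵤ⇒∣ 3∣1+2v) (∣ᵤ⇒∣ 3∣L))
    where
    eq : + suc (2 ℕ.* v) ℤ.- + L ≡ K ℤ.- + 1
    eq = begin
      + suc (2 ℕ.* v) ℤ.- + L
        ≡⟨ solve 2 (λ x l → x :- l := x :- (l :+ l :- l)) ≡.refl (+ suc (2 ℕ.* v)) (+ L) ⟩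
      + suc (2 ℕ.* v) ℤ.- (+ L ℤ.+ + L ℤ.- + L)
        ≡⟨ ≡.cong₂ (λ l l′ → + suc (2 ℕ.* v) ℤ.- (l ℤ.+ l ℤ.- l′)) (≡.cong +_ (≡.sym 1+v+N≡L)) (≡.sym K+2N≡L) ⟩
      + suc (2 ℕ.* v) ℤ.- (+ (suc v ℕ.+ N) ℤ.+ + (suc v ℕ.+ N) ℤ.- (K ℤ.+ + (2 ℕ.* N)))
        ≡⟨ solve 3 (λ K v n → con (+ 1) :+ (v :+ (v :+ con (+ 0))) :- ((con (+ 1) :+ v :+ n) :+ (con (+ 1) :+ v :+ n) :- (K :+ (n :+ (n :+ con (+ 0)))))
                           := K :- con (+ 1)) ≡.refl K (+ v) (+ N) ⟩
      K ℤ.- + 1 ∎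

  -- For N = W = 1 + v the relation becomes K + 1 = L - (1 + 2 v).
  3∣K+1 : ∀ {v} → 3 ℕ.∣ L → 3 ℕ.∣ suc (2 ℕ.* v) → suc v ≡ N → + 3 ∣ₛ K ℤ.+ + 1
  3∣K+1 {v} 3∣L 3∣1+2v ≡.refl = ≡.subst (+ 3 ∣ₛ_) eq (∣m∣n⇒∣m-n {m = + L} {n = + suc (2 ℕ.* v)} (∣ᵤ⇒∣ 3∣L) (∣ᵤ⇒∣ 3∣1+2v))
    where
    eq : + L ℤ.- + suc (2 ℕ.* v) ≡ K ℤ.+ + 1
    eq = begin
      + L ℤ.- + suc (2 ℕ.* v)                            ≡⟨ ≡.cong (λ l → l ℤ.- + suc (2 ℕ.* v)) K+2N≡L ⟨
      K ℤ.+ + (2 ℕ.* suc v) ℤ.- + suc (2 ℕ.* v)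
        ≡⟨ solve 2 (λ K v → K :+ (con (+ 1) :+ v :+ (con (+ 1) :+ v :+ con (+ 0))) :- (con (+ 1) :+ (v :+ (v :+ con (+ 0)))) := K :+ con (+ 1)) ≡.refl K (+ v) ⟩
      K ℤ.+ + 1                                          ∎

  12∣ : ∀ {i} → + 4 ∣ₛ i → + 3 ∣ₛ i → + 12 ∣ i
  12∣ 4∣i 3∣i = lcm-least (∣⇒∣ᵤ 4∣i) (∣⇒∣ᵤ 3∣i)

  12∣K-7 : + 4 ∣ₛ K ℤ.+ + 1 → + 3 ∣ₛ K ℤ.- + 1 → + 12 ∣ K ℤ.- + 7
  12∣K-7 4∣ 3∣ = 12∣
    -- The residue 7 is -1 + 8 modulo 4 and 1 + 6 modulo 3.
    (≡.subst (+ 4 ∣ₛ_) (solve 1 (λ K → K :+ con (+ 1) :- con (+ 8) := K :- con (+ 7)) ≡.refl K) (∣m∣n⇒∣m-n 4∣ (dividesₛ (+ 2) ≡.refl)))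
    (≡.subst (+ 3 ∣ₛ_) (solve 1 (λ K → K :- con (+ 1) :- con (+ 6) := K :- con (+ 7)) ≡.refl K) (∣m∣n⇒∣m-n 3∣ (dividesₛ (+ 2) ≡.refl)))

  12∣K-11 : + 4 ∣ₛ K ℤ.+ + 1 → + 3 ∣ₛ K ℤ.+ + 1 → + 12 ∣ K ℤ.- + 11
  12∣K-11 4∣ 3∣ = ≡.subst (+ 12 ∣_) (solve 1 (λ K → K :+ con (+ 1) :- con (+ 12) := K :- con (+ 11)) ≡.refl K)
    (12∣ (∣m∣n⇒∣m-n 4∣ (dividesₛ (+ 3) ≡.refl)) (∣m∣n⇒∣m-n 3∣ (dividesₛ (+ 4) ≡.refl)))

-- The Kloosterman sum and its negative terms.

module Kloosterman {c ℓ : Level} {m n : ℕ} (F : FiniteField2^ m c ℓ) (m≡1+n : m ≡ suc n)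
  (Tr≡T : ∀ x → FiniteField2^.Tr F x ≡ PartialTrace.T F m x) (a : FiniteField2^.Carrier F)
  (a≉0 : ¬ (FiniteField2^._≈_ F a (FiniteField2^.0# F)))
  (a≉1 : ¬ (FiniteField2^._≈_ F a (FiniteField2^.1# F)))
  (a³≈1 : FiniteField2^._≈_ F (FiniteField2^._*_ F (FiniteField2^._*_ F a a) a) (FiniteField2^.1# F)) where
  open FiniteField2^ F hiding (zero)
  open FieldProperties F
  open Trace F m≡1+n Tr≡T
  open CubeRoot F a a≉0 a≉1 a³≈1
  open 𝔽₄Solver using (Polynomial; solve; con; _:+_; _:*_; _:=_)
  open Data.List.Membership.Setoid setoid using (_∈_)
  open Data.List.Relation.Unary.Unique.Setoid setoid using (Unique)
  open Data.List.Relation.Binary.Permutation.Setoid setoid using (_↭_; ↭-sym)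
  open Data.List.Relation.Binary.Permutation.Setoid.Properties setoid using (xs↭ys⇒|xs|≡|ys|; Unique-resp-↭; ∈-resp-↭)
  open UniqueLists setoid
  open Algebra.Properties.Ring ring using (+-cancelˡ; +-cancelʳ)
  open Relation.Binary.Reasoning.Setoid setoid

  private
    :a :1 : ∀ {n} → Polynomial n
    :a = con (false , true)
    :1 = con (true , false)

  f : Carrier → Carrier
  f x = a * x + x ⁻¹

  f-cong : ∀ {x y} → ¬ (x ≈ 0#) → x ≈ y → f x ≈ f y
  f-cong x≉0 x≈y = +-cong (*-congˡ x≈y) (⁻¹-cong x≉0 x≈y)

  negative? : ∀ x → Dec (¬ (Tr (f x) ≈ 0#))
  negative? x = ¬? (Tr (f x) ≟ 0#)

  negatives : List Carrier
  negatives = filter negative? nonzero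

  -- Every summand becomes 1 once 2 is added to each -1; the additive form avoids subtraction in the
  -- induction.
  K+2|negative| : K a ℤ.+ + (2 ℕ.* length negatives) ≡ + length nonzero
  K+2|negative| = sum nonzero
    where
    open ℤ.+-*-Solver using () renaming (solve to solveℤ; con to conℤ; _:+_ to _⊕_; _:=_ to _≔_)

    signs : List Carrier → ℤ
    signs xs = foldr ℤ._+_ (+ 0) (map (λ x → sign (f x)) xs)

    2negatives : List Carrier → ℕ
    2negatives xs = 2 ℕ.* length (filter negative? xs)

    sum : ∀ xs → signs xs ℤ.+ + 2negatives xs ≡ + length xs
    sum []       = ≡.refl
    sum (x ∷ xs) with Tr (f x) ≟ 0#
    ... | yes _ = ≡.trans (ℤ.+-assoc (+ 1) (signs xs) (+ 2negatives xs)) (≡.cong ℤ.suc (sum xs))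
    ... | no  _ = ≡.trans (≡.cong (λ n → ℤ.-1ℤ ℤ.+ signs xs ℤ.+ + n) (ℕ.*-suc 2 (length (filter negative? xs))))
                 (≡.trans (solveℤ 2 (λ s n → (conℤ ℤ.-1ℤ ⊕ s) ⊕ (conℤ (+ 2) ⊕ n) ≔ conℤ (+ 1) ⊕ (s ⊕ n)) ≡.refl (signs xs) (+ 2negatives xs))
                          (≡.cong ℤ.suc (sum xs)))

  -- The involution behind the congruence modulo 4.

  2∣|negative| : 2 ℕ.∣ length negatives
  2∣|negative| = 2∣length σ²≈id negatives (Unique.filter⁺ setoid negative? nonzero!) (∈negatives⇒D , closed)
    where
    D : Carrier → Set _
    D x = ¬ (x ≈ 0#) × ¬ (Tr (f x) ≈ 0#)

    σ : Carrier → Carrier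
    σ x = (a * x) ⁻¹

    ax≉0 : ∀ {x} → D x → ¬ (a * x ≈ 0#)
    ax≉0 (x≉0 , _) = *-≉0 a≉0 x≉0

    σx⁻¹≈ax : ∀ {x} → D x → σ x ⁻¹ ≈ a * x
    σx⁻¹≈ax Dx = sym (x*y≈1⇒y≈x⁻¹ (trans (*-comm _ _) (inverseʳ _ (ax≉0 Dx))))

    aσx≈x⁻¹ : ∀ {x} → D x → a * σ x ≈ x ⁻¹
    aσx≈x⁻¹ {x} Dx = x*y≈1⇒y≈x⁻¹ (begin
      x * (a * σ x)   ≈⟨ solve 2 (λ x s → x :* (:a :* s) := :a :* x :* s) refl x (σ x) ⟩
      a * x * σ x     ≈⟨ inverseʳ _ (ax≉0 Dx) ⟩
      1#              ∎)

    σ²≈id : ∀ {x} → D x → σ (σ x) ≈ x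
    σ²≈id {x} Dx@(x≉0 , _) = sym (x*y≈1⇒y≈x⁻¹ (trans (*-congʳ (aσx≈x⁻¹ Dx)) (trans (*-comm _ x) (inverseʳ x x≉0))))

    -- A fixed point has x⁻¹ = a x, so the two terms of `f x` cancel. The point x = a is in fact
    -- fixed, hence the trace condition in `D`.
    σ-free : ∀ {x} → D x → ¬ (σ x ≈ x)
    σ-free {x} Dx@(x≉0 , Tr≉0) σx≈x = Tr≉0 (begin
      Tr (a * x + x ⁻¹)      ≈⟨ Tr-cong (+-congˡ (⁻¹-cong x≉0 (sym σx≈x))) ⟩
      Tr (a * x + σ x ⁻¹)    ≈⟨ Tr-cong (+-congˡ (σx⁻¹≈ax Dx)) ⟩
      Tr (a * x + a * x)     ≈⟨ Tr-+ _ _ ⟩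
      Tr (a * x) + Tr (a * x) ≈⟨ x+x≈0 _ ⟩
      0#                     ∎)

    open FreeAction D σ (λ Dx _ x≈y → ⁻¹-cong (ax≉0 Dx) (*-congˡ x≈y)) σ-free

    ∈negatives⇒D : ∀ {x} → x ∈ negatives → D x
    ∈negatives⇒D x∈ with x∈nz , y , x≈y , y-negative ← ∈-filter⁻ negative? nonzero x∈ =
      nonzero⇒≉0 x∈nz , λ Tr≈0 → y-negative (trans (Tr-cong (sym (f-cong (nonzero⇒≉0 x∈nz) x≈y))) Tr≈0)

    closed : ∀ {x} → x ∈ negatives → σ x ∈ negatives
    closed {x} x∈ = ∈-filter⁺ negative? (∈-nonzero σx≉0) λ {y} σx≈y Tr≈0 → proj₂ Dx (begin
      Tr (a * x + x ⁻¹)           ≈⟨ Tr-cong (+-cong (σx⁻¹≈ax Dx) (aσx≈x⁻¹ Dx)) ⟨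
      Tr (σ x ⁻¹ + a * σ x)       ≈⟨ Tr-cong (+-comm _ _) ⟩
      Tr (f (σ x))                ≈⟨ Tr-cong (f-cong σx≉0 σx≈y) ⟩
      Tr (f y)                    ≈⟨ Tr≈0 ⟩
      0#                          ∎)
      where
      Dx = ∈negatives⇒D x∈
      σx≉0 = ⁻¹-≉0 (ax≉0 Dx)

  -- By additive Hilbert 90 this is the condition for y² + y = f x + a² to have a root `y`.
  solvable? : ∀ x → Dec (Tr (f x + a * a) ≈ 0#)
  solvable? x = Tr (f x + a * a) ≟ 0#

  solvables : List Carrier
  solvables = filter solvable? nonzero

  solvable! : Unique solvables
  solvable! = Unique.filter⁺ setoid solvable? nonzero!

  ∈solvable : ∀ {v} → ¬ (v ≈ 0#) → Tr (f v + a * a) ≈ 0# → v ∈ solvables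
  ∈solvable v≉0 Tr≈0 = ∈-filter⁺ solvable? (∈-nonzero v≉0) λ v≈x → trans (Tr-cong (+-congʳ (sym (f-cong v≉0 v≈x)))) Tr≈0

  -- At v = 1 the value is a + 1 + a² = 0. This abscissa is later set aside because `α` inverts 1 +
  -- v.
  1∈solvable : 1# ∈ solvables
  1∈solvable = ∈solvable 1≉0 (begin
    Tr (a * 1# + 1# ⁻¹ + a * a)   ≈⟨ Tr-cong (+-congʳ (+-congˡ (x*y≈1⇒y≈x⁻¹ (*-identityʳ 1#)))) ⟨
    -- Zero is written as 1² + 1 so that `Tr-y²+y` applies.
    Tr (a * 1# + 1# + a * a)      ≈⟨ Tr-cong (solve 0 (:a :* :1 :+ :1 :+ :a :* :a := :1 :* :1 :+ :1) refl) ⟩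
    Tr (1# * 1# + 1#)             ≈⟨ Tr-y²+y 1# ⟩
    0#                            ∎)

  IsAbscissa : Carrier → Set _
  IsAbscissa v = ¬ (v ≈ 0#) × ¬ (v ≈ 1#) × Tr (f v + a * a) ≈ 0#

  -- The cubic curve and its parametrisation.

  Point : Set _
  Point = Carrier × Carrier

  pointSetoid = ×-setoid setoid setoid

  open Setoid pointSetoid using () renaming (_≈_ to _≈ₚ_)
  open Data.List.Membership.Setoid pointSetoid using () renaming (_∈_ to _∈ₚ_)
  open Data.List.Relation.Unary.Unique.Setoid pointSetoid using () renaming (Unique to Uniqueₚ)

  OnCurve : Point → Set _
  OnCurve (A , B) = A * B * (A + B + 1#) ≈ a

  OnCurve-resp : ∀ {p q} → p ≈ₚ q → OnCurve q → OnCurve p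
  OnCurve-resp (A≈ , B≈) = trans (*-cong (*-cong A≈ B≈) (+-congʳ (+-cong A≈ B≈)))

  -- For fixed A the curve equation is quadratic in B; the substitution
  -- A = 1/(1+v), B = A (v y + a² + a v) turns it into y² + y = f v + a².
  -- The value A = 1 is the only one missed.
  α : Carrier → Carrier
  α v = (1# + v) ⁻¹

  Q : Carrier → Carrier → Carrier
  Q v y = v * y + a * a + a * v

  Q-cong : ∀ {v v′ y y′} → v ≈ v′ → y ≈ y′ → Q v y ≈ Q v′ y′
  Q-cong v≈ y≈ = +-cong (+-congʳ (*-cong v≈ y≈)) (*-congˡ v≈)

  point : Carrier → Carrier → Point
  point v y = α v , α v * Q v y

  private
    :Q : ∀ {n} → Polynomial n → Polynomial n → Polynomial n
    :Q v y = v :* y :+ :a :* :a :+ :a :* v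

  -- Dividing the curve equation by A³, where 1/A = 1 + v, leaves Q (Q + v) = a (1 + v)³. In this
  -- left-hand side `y` occurs only through y² + y.
  Q[Q+v] : ∀ v y → Q v y * (Q v y + v) ≈ v * v * (y * y + y) + (v * v + a * a * v + a)
  Q[Q+v] = solve 2 (λ v y → :Q v y :* (:Q v y :+ v) := v :* v :* (y :* y :+ y) :+ (v :* v :+ :a :* :a :* v :+ :a)) refl

  -- Compared with `Q[Q+v]`, this says that the divided equation holds exactly when y² + y = f v +
  -- a², as v² can be cancelled.
  v²[fv+a²] : ∀ {v} → ¬ (v ≈ 0#) →
    v * v * (f v + a * a) + (v * v + a * a * v + a) ≈ a * ((1# + v) * (1# + v) * (1# + v))
  v²[fv+a²] {v} v≉0 = begin
    v * v * (a * v + e + a * a) + (v * v + a * a * v + a)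
      -- The inverse `e` is a free variable for the solver; the discrepancy is a multiple of v e +
      -- 1, which vanishes.
      ≈⟨ solve 2 (λ v e → v :* v :* (:a :* v :+ e :+ :a :* :a) :+ (v :* v :+ :a :* :a :* v :+ :a)
                       := :a :* ((:1 :+ v) :* (:1 :+ v) :* (:1 :+ v)) :+ v :* (v :* e :+ :1)) refl v e ⟩
    a * ((1# + v) * (1# + v) * (1# + v)) + v * (v * e + 1#)
      ≈⟨ +-congˡ (*-congˡ (trans (+-congʳ (inverseʳ v v≉0)) 1+1≈0)) ⟩
    a * ((1# + v) * (1# + v) * (1# + v)) + v * 0#
      ≈⟨ trans (+-congˡ (zeroʳ v)) (+-identityʳ _) ⟩
    a * ((1# + v) * (1# + v) * (1# + v)) ∎
    where e = v ⁻¹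

  1+v≉0 : ∀ {v} → ¬ (v ≈ 1#) → ¬ (1# + v ≈ 0#)
  1+v≉0 v≉1 1+v≈0 = v≉1 (sym (x+y≈0⇒x≈y 1+v≈0))

  point-onCurve : ∀ {v y} → ¬ (v ≈ 0#) → ¬ (v ≈ 1#) → y * y + y ≈ f v + a * a → OnCurve (point v y)
  point-onCurve {v} {y} v≉0 v≉1 y²+y≈ = begin
    A * (A * q) * (A + A * q + 1#)
      -- Replacing 1 by A (1 + v) makes the expression homogeneous of degree 3 in `A`.
      ≈⟨ *-congˡ (+-congˡ Au≈1) ⟨
    A * (A * q) * (A + A * q + A * (1# + v))
      ≈⟨ solve 3 (λ A q v → A :* (A :* q) :* (A :+ A :* q :+ A :* (:1 :+ v)) := A :* A :* A :* (q :* (q :+ v))) refl A q v ⟩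
    A * A * A * (q * (q + v))
      ≈⟨ *-congˡ (trans (Q[Q+v] v y) (trans (+-congʳ (*-congˡ y²+y≈)) (v²[fv+a²] v≉0))) ⟩
    A * A * A * (a * (u * u * u))
      ≈⟨ solve 2 (λ A u → A :* A :* A :* (:a :* (u :* u :* u)) := :a :* ((A :* u) :* (A :* u) :* (A :* u))) refl A u ⟩
    a * ((A * u) * (A * u) * (A * u))
      ≈⟨ *-congˡ (*-cong (*-cong Au≈1 Au≈1) Au≈1) ⟩
    a * (1# * 1# * 1#)
      ≈⟨ solve 0 (:a :* (:1 :* :1 :* :1) := :a) refl ⟩
    a ∎
    where
    A = α v
    q = Q v y
    u = 1# + v
    Au≈1 : A * u ≈ 1#
    Au≈1 = trans (*-comm _ _) (inverseʳ u (1+v≉0 v≉1))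

  y : Carrier → Carrier
  y v = solution (f v + a * a)

  y-solves : ∀ {v} → IsAbscissa v → y v * y v + y v ≈ f v + a * a
  y-solves (_ , _ , Tr≈0) = solution-y²+y Tr≈0

  y+1-solves : ∀ {v} → IsAbscissa v → (y v + 1#) * (y v + 1#) + (y v + 1#) ≈ f v + a * a
  y+1-solves {v} abs = trans (solve 1 (λ y → (y :+ :1) :* (y :+ :1) :+ (y :+ :1) := y :* y :+ y) refl (y v)) (y-solves abs)

  points : List Carrier → List Point
  points []       = []
  points (v ∷ vs) = point v (y v) ∷ point v (y v + 1#) ∷ points vs

  |points| : ∀ vs → length (points vs) ≡ 2 ℕ.* length vs
  |points| []       = ≡.refl
  |points| (v ∷ vs) = ≡.trans (≡.cong (2 ℕ.+_) (|points| vs)) (≡.sym (ℕ.*-suc 2 (length vs)))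

  All-points : ∀ {p} {P : Carrier → Set p} {vs} → All (λ v → P (α v)) vs → All (λ q → P (proj₁ q)) (points vs)
  All-points []         = []
  All-points (Pv ∷ Pvs) = Pv ∷ Pv ∷ All-points Pvs

  ∈-points : ∀ {p vs} → Any (λ v → p ≈ₚ point v (y v) ⊎ p ≈ₚ point v (y v + 1#)) vs → p ∈ₚ points vs
  ∈-points (here (inj₁ p≈)) = here p≈
  ∈-points (here (inj₂ p≈)) = there (here p≈)
  ∈-points (there p∈)       = there (there (∈-points p∈))

  points-onCurve : ∀ {vs} → (∀ {v} → v ∈ vs → IsAbscissa v) → ∀ {p} → p ∈ₚ points vs → OnCurve p
  points-onCurve {v ∷ vs} abs p∈ with abs (here refl)
  points-onCurve {v ∷ vs} abs (here p≈)         | av@(v≉0 , v≉1 , _) = OnCurve-resp p≈ (point-onCurve v≉0 v≉1 (y-solves av))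
  points-onCurve {v ∷ vs} abs (there (here p≈)) | av@(v≉0 , v≉1 , _) = OnCurve-resp p≈ (point-onCurve v≉0 v≉1 (y+1-solves av))
  points-onCurve {v ∷ vs} abs (there (there p∈)) | _ = points-onCurve (abs ∘ there) p∈

  α-injective : ∀ {v w} → ¬ (v ≈ 1#) → ¬ (w ≈ 1#) → α v ≈ α w → v ≈ w
  α-injective v≉1 w≉1 αv≈αw = +-cancelˡ 1# _ _ (*-cancelʳ (⁻¹-≉0 (1+v≉0 v≉1))
    (trans (inverseʳ _ (1+v≉0 v≉1)) (sym (trans (*-congˡ αv≈αw) (inverseʳ _ (1+v≉0 w≉1))))))

  -- Different abscissae give different first coordinates because `α` is injective. Over one
  -- abscissa the roots y and y + 1 give values of `Q` differing by v, which is nonzero.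
  points! : ∀ {vs} → Unique vs → (∀ {v} → v ∈ vs → IsAbscissa v) → Uniqueₚ (points vs)
  points! {[]} _ _ = []
  points! {v ∷ vs} (v≉vs ∷ vs!) abs = (distinct ∷ All.map (λ α≉ p≈ → α≉ (proj₁ p≈)) fresh) ∷ All.map (λ α≉ p≈ → α≉ (proj₁ p≈)) fresh ∷ points! vs! (abs ∘ there)
    where
    v≉0 = proj₁ (abs (here refl))
    v≉1 = proj₁ (proj₂ (abs (here refl)))

    distinct : ¬ (point v (y v) ≈ₚ point v (y v + 1#))
    distinct (_ , αQ≈) = v≉0 (begin
      v                               ≈⟨ solve 2 (λ v y → v := :Q v y :+ :Q v (y :+ :1)) refl v (y v) ⟩
      Q v (y v) + Q v (y v + 1#)      ≈⟨ +-congʳ (*-cancelˡ (⁻¹-≉0 (1+v≉0 v≉1)) αQ≈) ⟩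
      Q v (y v + 1#) + Q v (y v + 1#) ≈⟨ x+x≈0 _ ⟩
      0#                              ∎)

    fresh : All (λ p → ¬ (α v ≈ proj₁ p)) (points vs)
    fresh = All-points (All.tabulateₛ setoid λ w∈ αv≈αw →
      All≉⇒∉ v≉vs (Membership.∈-resp-≈ setoid (sym (α-injective v≉1 (proj₁ (proj₂ (abs (there w∈)))) αv≈αw)) w∈))

  -- Enumeration of the curve and its symmetry of order 3.

  module Curve {V : List Carrier} (solvable↭1∷V : solvables ↭ 1# ∷ V) where

    1∷V! : Unique (1# ∷ V)
    1∷V! = Unique-resp-↭ solvable↭1∷V solvable!

    V⇒abscissa : ∀ {v} → v ∈ V → IsAbscissa v
    V⇒abscissa {v} v∈V with v∈nz , x , v≈x , Tr≈0 ← ∈-filter⁻ solvable? nonzero (∈-resp-↭ (↭-sym solvable↭1∷V) (there v∈V)) =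
      v≉0 , ∉-tail 1∷V! v∈V , trans (Tr-cong (+-congʳ (f-cong v≉0 v≈x))) Tr≈0
      where v≉0 = nonzero⇒≉0 v∈nz

    abscissa⇒V : ∀ {v} → IsAbscissa v → v ∈ V
    abscissa⇒V (v≉0 , v≉1 , Tr≈0) = ∈-tail (∈-resp-↭ solvable↭1∷V (∈solvable v≉0 Tr≈0)) v≉1

    curve : List Point
    curve = (1# , a * a) ∷ points V

    curve! : Uniqueₚ curve
    curve! = All.map (λ 1≉ p≈ → 1≉ (proj₁ p≈)) (All-points {P = λ A → ¬ (1# ≈ A)} (All.tabulateₛ setoid 1≉α)) ∷ points! (unique-tail 1∷V!) V⇒abscissa
      where
      1≉α : ∀ {v} → v ∈ V → ¬ (1# ≈ α v)
      1≉α {v} v∈ 1≈αv with v≉0 , v≉1 , _ ← V⇒abscissa v∈ = v≉0 (+-cancelˡ 1# v 0# (begin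
        1# + v           ≈⟨ *-identityʳ _ ⟨
        (1# + v) * 1#    ≈⟨ *-congˡ 1≈αv ⟩
        (1# + v) * α v   ≈⟨ inverseʳ _ (1+v≉0 v≉1) ⟩
        1#               ≈⟨ +-identityʳ 1# ⟨
        1# + 0#          ∎))

    curve-sound : ∀ {p} → p ∈ₚ curve → OnCurve p
    curve-sound (here p≈)  = OnCurve-resp p≈ (solve 0 (:1 :* (:a :* :a) :* (:1 :+ :a :* :a :+ :1) := :a) refl)
    curve-sound (there p∈) = points-onCurve V⇒abscissa p∈

    -- Inverts the substitution: `A` determines v = 1 + 1/A, and `z` below solves z² + z = f v + a².
    -- Hence `v` is an abscissa, and `z` is one of the two listed roots.
    curve-complete : ∀ {p} → OnCurve p → p ∈ₚ curve
    curve-complete {A , B} AB[A+B+1]≈a with A ≟ 1#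
    -- For A = 1 the equation reads B² = a, and a = a⁴ is the square of a².
    ... | yes A≈1 = here (A≈1 , square-injective (begin
      B * B                    ≈⟨ solve 1 (λ B → B :* B := :1 :* B :* (:1 :+ B :+ :1)) refl B ⟩
      1# * B * (1# + B + 1#)   ≈⟨ *-cong (*-congʳ (sym A≈1)) (+-congʳ (+-congʳ (sym A≈1))) ⟩
      A * B * (A + B + 1#)     ≈⟨ AB[A+B+1]≈a ⟩
      a                        ≈⟨ solve 0 (:a := :a :* :a :* (:a :* :a)) refl ⟩
      a * a * (a * a)          ∎))
    ... | no A≉1 = there (∈-points (Any.map match (abscissa⇒V (v≉0 , v≉1 , Tr≈0))))
      where
      A≉0 : ¬ (A ≈ 0#)
      A≉0 A≈0 = a≉0 (trans (sym AB[A+B+1]≈a) (trans (*-assoc _ _ _) (trans (*-congʳ A≈0) (zeroˡ _))))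

      u = A ⁻¹
      v = 1# + u

      Au≈1 : A * u ≈ 1#
      Au≈1 = inverseʳ A A≉0

      v≉0 : ¬ (v ≈ 0#)
      v≉0 v≈0 = A≉1 (trans (sym (*-identityʳ A)) (trans (*-congˡ (x+y≈0⇒x≈y v≈0)) Au≈1))

      v≉1 : ¬ (v ≈ 1#)
      v≉1 v≈1 = ⁻¹-≉0 A≉0 (+-cancelˡ 1# u 0# (trans v≈1 (sym (+-identityʳ 1#))))

      1+v≈u : 1# + v ≈ u
      1+v≈u = solve 1 (λ u → :1 :+ (:1 :+ u) := u) refl u

      -- Obtained by solving Q v z = B / A for `z`.
      z = v ⁻¹ * (B * u + a * a + a * v)

      Qvz≈Bu : Q v z ≈ B * u
      Qvz≈Bu = begin
        v * (v ⁻¹ * (B * u + a * a + a * v)) + a * a + a * v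
          ≈⟨ solve 3 (λ v e w → v :* (e :* (w :+ :a :* :a :+ :a :* v)) :+ :a :* :a :+ :a :* v
                             := v :* e :* (w :+ :a :* :a :+ :a :* v) :+ :a :* :a :+ :a :* v) refl v (v ⁻¹) (B * u) ⟩
        v * v ⁻¹ * (B * u + a * a + a * v) + a * a + a * v
          ≈⟨ +-congʳ (+-congʳ (*-congʳ (inverseʳ v v≉0))) ⟩
        1# * (B * u + a * a + a * v) + a * a + a * v
          ≈⟨ solve 2 (λ v w → :1 :* (w :+ :a :* :a :+ :a :* v) :+ :a :* :a :+ :a :* v := w) refl v (B * u) ⟩
        B * u ∎

      z²+z≈ : z * z + z ≈ f v + a * a
      -- Adding the common remainder and multiplying by v² brings both sides into the form of
      -- `Q[Q+v]` and `v²[fv+a²]`; the curve equation multiplied by u³ connects them.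
      z²+z≈ = *-cancelˡ (*-≉0 v≉0 v≉0) (+-cancelʳ (v * v + a * a * v + a) _ _ (begin
        v * v * (z * z + z) + (v * v + a * a * v + a)       ≈⟨ Q[Q+v] v z ⟨
        Q v z * (Q v z + v)                                 ≈⟨ *-cong Qvz≈Bu (+-congʳ Qvz≈Bu) ⟩
        B * u * (B * u + (1# + u))                          ≈⟨ solve 2 (λ w u → w :* (w :+ (:1 :+ u)) := :1 :* w :* (:1 :+ w :+ u)) refl (B * u) u ⟩
        1# * (B * u) * (1# + B * u + u)                     ≈⟨ *-cong (*-congʳ Au≈1) (+-congʳ (+-congʳ Au≈1)) ⟨
        A * u * (B * u) * (A * u + B * u + u)               ≈⟨ solve 3 (λ A B u → A :* u :* (B :* u) :* (A :* u :+ B :* u :+ u) := A :* B :* (A :+ B :+ :1) :* (u :* u :* u)) refl A B u ⟩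
        A * B * (A + B + 1#) * (u * u * u)                  ≈⟨ *-cong AB[A+B+1]≈a (sym (*-cong (*-cong 1+v≈u 1+v≈u) 1+v≈u)) ⟩
        a * ((1# + v) * (1# + v) * (1# + v))                ≈⟨ v²[fv+a²] v≉0 ⟨
        v * v * (f v + a * a) + (v * v + a * a * v + a)     ∎))

      Tr≈0 : Tr (f v + a * a) ≈ 0#
      Tr≈0 = trans (Tr-cong (sym z²+z≈)) (Tr-y²+y z)

      -- The list contains `v` only up to `≈`, so the point is compared at a representative `w`.
      p≈ : ∀ {w t} → v ≈ w → z ≈ t → (A , B) ≈ₚ point w t
      p≈ {w} {t} v≈w z≈t = A≈αw , (begin
        B              ≈⟨ *-identityʳ B ⟨
        B * 1#         ≈⟨ *-congˡ Au≈1 ⟨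
        B * (A * u)    ≈⟨ solve 3 (λ A B u → B :* (A :* u) := A :* (B :* u)) refl A B u ⟩
        A * (B * u)    ≈⟨ *-congˡ Qvz≈Bu ⟨
        A * Q v z      ≈⟨ *-cong A≈αw (Q-cong v≈w z≈t) ⟩
        α w * Q w t    ∎)
        where
        A≈αw : A ≈ α w
        A≈αw = x*y≈1⇒y≈x⁻¹ (trans (*-congʳ (trans (+-congˡ (sym v≈w)) 1+v≈u)) (trans (*-comm u A) Au≈1))

      match : ∀ {w} → v ≈ w → (A , B) ≈ₚ point w (y w) ⊎ (A , B) ≈ₚ point w (y w + 1#)
      match {w} v≈w = Sum.map (p≈ v≈w) (p≈ v≈w) (y²+y-injective (trans z²+z≈ (trans fv≈fw (sym (y-solves
        (v≉0 ∘ trans v≈w , v≉1 ∘ trans v≈w , trans (Tr-cong (sym fv≈fw)) Tr≈0))))))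
        where
        fv≈fw : f v + a * a ≈ f w + a * a
        fv≈fw = +-congʳ (f-cong v≉0 v≈w)

    3∣|curve| : 3 ℕ.∣ length curve
    3∣|curve| = 3∣length σ³≈id curve curve! (curve-sound , λ p∈ → curve-complete (σ-onCurve (curve-sound p∈)))
      where
      σ : Point → Point
      σ (A , B) = B , A + B + 1#

      -- A fixed point must be (1 , 1), where the cubic has the value 1 instead of `a`.
      σ-free : ∀ {p} → OnCurve p → ¬ (σ p ≈ₚ p)
      σ-free {A , B} onCurve (B≈A , A+B+1≈B) = a≉1 (begin
        a                            ≈⟨ onCurve ⟨
        A * B * (A + B + 1#)         ≈⟨ *-cong (*-cong A≈1 B≈1) (+-congʳ (+-cong A≈1 B≈1)) ⟩
        1# * 1# * (1# + 1# + 1#)     ≈⟨ solve 0 (:1 :* :1 :* (:1 :+ :1 :+ :1) := :1) refl ⟩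
        1#                           ∎)
        where
        A≈1 : A ≈ 1#
        A≈1 = x+y≈0⇒x≈y (begin
          A + 1#              ≈⟨ solve 2 (λ A B → A :+ :1 := (A :+ B :+ :1) :+ B) refl A B ⟩
          A + B + 1# + B      ≈⟨ +-congʳ A+B+1≈B ⟩
          B + B               ≈⟨ x+x≈0 B ⟩
          0#                  ∎)
        B≈1 = trans B≈A A≈1

      σ-onCurve : ∀ {p} → OnCurve p → OnCurve (σ p)
      σ-onCurve {A , B} = trans
        (solve 2 (λ A B → B :* (A :+ B :+ :1) :* (B :+ (A :+ B :+ :1) :+ :1) := A :* B :* (A :+ B :+ :1)) refl A B)

      σ-cong : ∀ {p q} → OnCurve p → OnCurve q → p ≈ₚ q → σ p ≈ₚ σ q
      σ-cong _ _ (A≈ , B≈) = B≈ , +-congʳ (+-cong A≈ B≈)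

      open UniqueLists.FreeAction pointSetoid OnCurve σ (λ {p} {q} → σ-cong {p} {q}) σ-free

      σ³≈id : ∀ {p} → OnCurve p → σ (σ (σ p)) ≈ₚ p
      σ³≈id {A , B} _ =
        solve 2 (λ A B → B :+ (A :+ B :+ :1) :+ :1 := A) refl A B ,
        solve 2 (λ A B → (A :+ B :+ :1) :+ (B :+ (A :+ B :+ :1) :+ :1) :+ :1 := B) refl A B

  -- Writing W = 1 + n for the number of solvable abscissae, the curve has 1 + 2 n = 2 W - 1 points.
  3∣2|solvable|-1 : ∃ λ n → length solvables ≡ suc n × 3 ℕ.∣ suc (2 ℕ.* n)
  3∣2|solvable|-1 with V , solvable↭1∷V ← pull 1∈solvable =
    length V , xs↭ys⇒|xs|≡|ys| solvable↭1∷V , ≡.subst (λ n → 3 ℕ.∣ suc n) (|points| V) (Curve.3∣|curve| solvable↭1∷V)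

  -- Depending on `Tr a`, the shift by a² preserves or flips the trace of `f x`, so the solvable
  -- abscissae are either the complement of the negative ones or exactly those.
  Tr[fx+a²] : ∀ x → Tr (f x + a * a) ≈ Tr (f x) + Tr a
  Tr[fx+a²] x = trans (Tr-+ (f x) (a * a)) (+-congˡ (Tr-square a))

  |solvable|+|negative| : Tr a ≈ 0# → length solvables ℕ.+ length negatives ≡ length nonzero
  |solvable|+|negative| Tra≈0 = ≡.trans
    (≡.cong (λ xs → length xs ℕ.+ length negatives) (List.filter-≐ solvable? (λ x → Tr (f x) ≟ 0#)
      ((λ {x} → trans (sym (Tr≈ x))) , (λ {x} → trans (Tr≈ x))) nonzero))
    (length-filter-¬? (λ x → Tr (f x) ≟ 0#) nonzero)
    where
    Tr≈ : ∀ x → Tr (f x + a * a) ≈ Tr (f x)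
    Tr≈ x = trans (Tr[fx+a²] x) (trans (+-congˡ Tra≈0) (+-identityʳ _))

  |solvable|≡|negative| : Tr a ≈ 1# → length solvables ≡ length negatives
  |solvable|≡|negative| Tra≈1 = ≡.cong length (List.filter-≐ solvable? negative? (solvable⇒negative , negative⇒solvable) nonzero)
    where
    Tr≈ : ∀ x → Tr (f x + a * a) ≈ Tr (f x) + 1#
    Tr≈ x = trans (Tr[fx+a²] x) (+-congˡ Tra≈1)

    solvable⇒negative : ∀ {x} → Tr (f x + a * a) ≈ 0# → ¬ (Tr (f x) ≈ 0#)
    solvable⇒negative {x} isSolvable Tr≈0 = 1≉0 (trans (sym (+-identityˡ 1#)) (trans (+-congʳ (sym Tr≈0)) (trans (sym (Tr≈ x)) isSolvable)))

    negative⇒solvable : ∀ {x} → ¬ (Tr (f x) ≈ 0#) → Tr (f x + a * a) ≈ 0#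
    negative⇒solvable {x} isNegative = trans (Tr≈ x) (trans (+-congʳ (Tr≉0⇒Tr≈1 isNegative)) 1+1≈0)

  K-mod-12 : 4 ℕ.∣ 2 ℕ.^ m → (Tr a ≈ 0# → + 12 ∣ (K a ℤ.- + 7)) × (Tr a ≈ 1# → + 12 ∣ (K a ℤ.- + 11))
  K-mod-12 4∣2^m =
    let n , |solvable|≡1+n , 3∣1+2n = 3∣2|solvable|-1 in
    (λ Tra≈0 → 12∣K-7 4∣ (3∣K-1 3∣|nonzero| 3∣1+2n
      (≡.trans (≡.cong (ℕ._+ length negatives) (≡.sym |solvable|≡1+n)) (|solvable|+|negative| Tra≈0)))) ,
    (λ Tra≈1 → 12∣K-11 4∣ (3∣K+1 3∣|nonzero| 3∣1+2n (≡.trans (≡.sym |solvable|≡1+n) (|solvable|≡|negative| Tra≈1))))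
    where
    open Arithmetic {K a} {length negatives} K+2|negative|
    4∣ = 4∣K+1 2∣|negative| (≡.subst (4 ℕ.∣_) (≡.sym 1+|nonzero|≡2^m) 4∣2^m)

theorem5 : ∀ {c ℓ : Level} (m : ℕ) → m ≥ 1 → (F : FiniteField2^ m c ℓ) →
    ∀ (a : FiniteField2^.Carrier F) →
    ¬ (FiniteField2^._≈_ F a (FiniteField2^.0# F)) →
    ¬ (FiniteField2^._≈_ F a (FiniteField2^.1# F)) →
    FiniteField2^._≈_ F (FiniteField2^._*_ F (FiniteField2^._*_ F a a) a) (FiniteField2^.1# F) →
    ((FiniteField2^._≈_ F (FiniteField2^.Tr F a) (FiniteField2^.0# F) →
    (+ 12) ∣ (FiniteField2^.K F a ℤ.- + 7))
    × (FiniteField2^._≈_ F (FiniteField2^.Tr F a) (FiniteField2^.1# F) →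
    (+ 12) ∣ (FiniteField2^.K F a ℤ.- + 11)))
-- The field of order 2 has a single nonzero element, and 3 does not divide 1, so no such `a`
-- exists.
theorem5 1 _ F a a≉0 a≉1 a³≈1 = contradiction (≡.subst (3 ℕ.∣_) |nonzero|≡1 3∣|nonzero|) λ 3∣1 → contradiction (ℕ.∣⇒≤ 3∣1) λ { (s≤s ()) }
  where
  open FieldProperties F using (1+|nonzero|≡2^m)
  open CubeRoot F a a≉0 a≉1 a³≈1 using (3∣|nonzero|)
  |nonzero|≡1 = ℕ.suc-injective 1+|nonzero|≡2^m
-- The form m = 2 + k permits the two unfoldings of `Tr` and gives 4 ∣ 2^m.
theorem5 (suc (suc k)) _ F a a≉0 a≉1 a³≈1 =
  Kloosterman.K-mod-12 F ≡.refl (UnfoldTrace.Tr≡T F) a a≉0 a≉1 a³≈1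
    (≡.subst (4 ℕ.∣_) (ℕ.*-assoc 2 2 (2 ℕ.^ k)) (ℕ.m∣m*n (2 ℕ.^ k)))
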